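{- Let $d,e>1$ be integers, let $\lambda$ be an $e$-regular partition which is $d$-balanced (with respect to $e$), and let $i\in\{0,1,\dots,e-1\}$. Then $\sigma_i(\lambda)$ is also $d$-balanced (with respect to $e$).
   Context: A partition $\lambda=(\lambda_1\ge\lambda_2\ge\dots\ge\lambda_\ell>0)$ has Young diagram $[\lambda]=\{(r,c):1\le r\le \ell,\ 1\le c\le\lambda_r\}$; $\lambda'$ denotes the conjugate partition. It is $e$-regular if no part is repeated $e$ or more times. For $(r,c)\in[\lambda]$, the hook at $(r,c)$ consists of $(r,c)$, the nodes strictly to its right in row $r$ and the nodes strictly below it in column $c$. Its arm length is $a_{rc}(\lambda)=\lambda_r-c$, its leg length is $\lambda'_c-r$, and its hook length is $h_{rc}(\lambda)=a_{rc}(\lambda)+(\lambda'_c-r)+1$. The partition $\lambda$ is $d$-balanced (with respect to $e$) if $d\mid a_{rc}(\lambda)$ for every node $(r,c)\in[\lambda]$ with $e\mid h_{rc}(\lambda)$. Affine reflections. A node is any pair $(r,c)$ of positive integers; its $e$-residue is the remainder of $c-r$ modulo $e$, in $\{0,\dots,e-1\}$. Rows are drawn with row $1$ at the top. A node of $e$-residue $i$ is $i$-removable (respectively $i$-addable) for $\lambda$ if removing it from (respectively adding it to) $[\lambda]$ gives the Young diagram of a partition. The $i$-signature of $\lambda$ is the sequence of signs obtained by labelling all $i$-addable nodes by $+$ and all $i$-removable nodes by $-$ and reading them along the rim from bottom left to upper right. The reduced $i$-signature is obtained by successively deleting neighbouring pairs $-+$ until none remain; it has the form $+\cdots+-\cdots-$.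 Let $\varphi_i(\lambda)$ and $\varepsilon_i(\lambda)$ be the numbers of $+$'s and $-$'s, respectively, in the reduced $i$-signature. If $\varepsilon_i(\lambda)>0$, let $\tilde e_i(\lambda)$ be $\lambda$ with the removable node corresponding to the leftmost $-$ of the reduced $i$-signature removed. If $\varphi_i(\lambda)>0$, let $\tilde f_i(\lambda)$ be $\lambda$ with the addable node corresponding to the rightmost $+$ of the reduced $i$-signature added. For an $e$-regular partition $\lambda$, the affine $i$-reflection is $$\sigma_i(\lambda)=\begin{cases}\tilde f_i^{\,\varphi_i(\lambda)-\varepsilon_i(\lambda)}(\lambda)&\text{if }\varepsilon_i(\lambda)<\varphi_i(\lambda),\\ \tilde e_i^{\,\varepsilon_i(\lambda)-\varphi_i(\lambda)}(\lambda)&\text{if }\varepsilon_i(\lambda)>\varphi_i(\lambda),\\ \lambda&\text{if }\varepsilon_i(\lambda)=\varphi_i(\lambda).\end{cases}$$ -}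

module Defs where

open import Data.Fin using (Fin; toℕ)
open import Data.Integer using (+_; _-_)
open import Data.Integer.DivMod using (_%ℕ_)
open import Data.List using (List; []; _∷_; _++_; concatMap; downFrom; filter; foldr; head; last; length; mapMaybe)
open import Data.List.Relation.Unary.All using (All; all?)
open import Data.List.Relation.Unary.Linked using (Linked; linked?)
open import Data.Maybe using (Maybe; just; nothing; map; _>>=_)
open import Data.Nat using (ℕ; zero; suc; pred; _+_; _∸_; _≥_; _<_; _>_; _≟_; _≥?_; _<?_; _>?_; NonZero)
open import Data.Nat.Divisibility using (_∣_)
open import Data.Nat.Properties using (<-cmp)
open import Data.Product using (_×_; _,_; ∃; proj₂)
open import Relation.Binary.Definitions using (tri<; tri≈; tri>)
open import Relation.Binary.PropositionalEquality using (_≡_)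
open import Relation.Nullary using (Dec; yes; no)
open import Relation.Nullary.Decidable using (_×-dec_)

IsPartition : List ℕ → Set
IsPartition xs = Linked _≥_ xs × All (_> 0) xs

isPartition? : ∀ xs → Dec (IsPartition xs)
isPartition? xs = linked? _≥?_ xs ×-dec all? (_>? 0) xs

record Partition : Set where
  constructor mkPartition
  field
    parts       : List ℕ
    isPartition : IsPartition parts

open Partition public

-- Rows and columns are numbered from 0: the pair (r , c) stands for the node
-- (r + 1, c + 1) of the usual convention.  The content c - r is unaffected.
Node : Set
Node = ℕ × ℕ

-- The length of row r of a list of row lengths, 0 below the last row.
rowLength : List ℕ → ℕ → ℕ
rowLength []       _       = 0
rowLength (x ∷ _)  zero    = x
rowLength (_ ∷ xs) (suc r) = rowLength xs r

row : Partition → ℕ → ℕ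
row p = rowLength (parts p)

-- The parts of the conjugate partition, as column lengths.
col : Partition → ℕ → ℕ
col p c = length (filter (c <?_) (parts p))

_∈[_] : Node → Partition → Set
(r , c) ∈[ p ] = r < length (parts p) × c < row p r

arm : Partition → Node → ℕ
arm p (r , c) = row p r ∸ suc c

leg : Partition → Node → ℕ
leg p (r , c) = col p c ∸ suc r

hook : Partition → Node → ℕ
hook p n = arm p n + leg p n + 1

Balanced : (d e : ℕ) → Partition → Set
Balanced d e p = ∀ n → n ∈[ p ] → e ∣ hook p n → d ∣ arm p n

Regular : ℕ → Partition → Set
Regular e p = ∀ k → length (filter (k ≟_) (parts p)) < e

-- Adding a node at the end of row r.  When r is beyond the first empty row the
-- result has a zero entry, so it is not a partition.
addBox : ℕ → List ℕ → List ℕ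
addBox zero    []       = 1 ∷ []
addBox zero    (x ∷ xs) = suc x ∷ xs
addBox (suc r) []       = 0 ∷ addBox r []
addBox (suc r) (x ∷ xs) = x ∷ addBox r xs

-- Removing the last node of row r.  A bottom row that becomes empty is dropped;
-- any other row that becomes empty leaves a zero entry, which is not allowed in
-- a partition.
removeBox : ℕ → List ℕ → List ℕ
removeBox _       []           = []
removeBox zero    (1 ∷ [])     = []
removeBox zero    (x ∷ xs)     = pred x ∷ xs
removeBox (suc r) (x ∷ xs)     = x ∷ removeBox r xs

-- Only the node just after (respectively at) the end of a row can be addable
-- (respectively removable), so these nodes are indexed by their row.
addNode removeNode : Partition → ℕ → Node
addNode    p r = r , row p r
removeNode p r = r , pred (row p r)

Addable : Partition → ℕ → Set
Addable p r = IsPartition (addBox r (parts p))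

Removable : Partition → ℕ → Set
Removable p r = row p r > 0 × IsPartition (removeBox r (parts p))

addable? : ∀ p r → Dec (Addable p r)
addable? p r = isPartition? (addBox r (parts p))

removable? : ∀ p r → Dec (Removable p r)
removable? p r = (row p r >? 0) ×-dec isPartition? (removeBox r (parts p))

add : ∀ p → ∃ (Addable p) → Partition
add p (r , a) = mkPartition (addBox r (parts p)) a

remove : ∀ p → ∃ (Removable p) → Partition
remove p (r , a) = mkPartition (removeBox r (parts p)) (proj₂ a)

data Sign (p : Partition) : Set where
  plus  : ∃ (Addable p)   → Sign p
  minus : ∃ (Removable p) → Sign p

pluses : ∀ {p} → List (Sign p) → List (∃ (Addable p))
pluses = mapMaybe λ { (plus a) → just a ; (minus _) → nothing }

minuses : ∀ {p} → List (Sign p) → List (∃ (Removable p))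
minuses = mapMaybe λ { (plus _) → nothing ; (minus a) → just a }

-- Prepends a sign to a list of the form +⋯+-⋯-, cancelling a pair -+ if one
-- arises; the result again has this form.
cancel : ∀ {p} → Sign p → List (Sign p) → List (Sign p)
cancel (minus _) (plus _ ∷ ss) = ss
cancel s         ss            = s ∷ ss

-- The pairs -+ are matched like brackets, so the surviving signs do not depend
-- on the order in which pairs are deleted.
reduce : ∀ {p} → List (Sign p) → List (Sign p)
reduce = foldr cancel []

iterate : (Partition → Maybe Partition) → ℕ → Partition → Maybe Partition
iterate g zero    p = just p
iterate g (suc n) p = g p >>= iterate g n

module _ (e : ℕ) .{{_ : NonZero e}} where

  residue : Node → ℕ
  residue (r , c) = (+ c - + r) %ℕ e

  module _ (i : Fin e) where

    removableSign addableSign : ∀ p → ℕ → List (Sign p)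
    removableSign p r with removable? p r ×-dec (residue (removeNode p r) ≟ toℕ i)
    ... | yes (a , _) = minus (r , a) ∷ []
    ... | no  _       = []
    addableSign p r with addable? p r ×-dec (residue (addNode p r) ≟ toℕ i)
    ... | yes (a , _) = plus (r , a) ∷ []
    ... | no  _       = []

    -- The rows are read upwards, starting with the empty row below the diagram.
    signature : ∀ p → List (Sign p)
    signature p = concatMap (λ r → removableSign p r ++ addableSign p r)
                            (downFrom (suc (length (parts p))))

    reducedSignature : ∀ p → List (Sign p)
    reducedSignature p = reduce (signature p)

    φ ε : Partition → ℕ
    φ p = length (pluses  (reducedSignature p))
    ε p = length (minuses (reducedSignature p))

    -- These are nothing exactly when ε p, respectively φ p, is 0.
    ẽ f̃ : Partition → Maybe Partition
    ẽ p = map (remove p) (head (minuses (reducedSignature p)))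
    f̃ p = map (add p)    (last (pluses  (reducedSignature p)))

    -- The reflection is meant for e-regular partitions, but the same recipe
    -- makes sense for every partition.
    σ : Partition → Maybe Partition
    σ p with <-cmp (ε p) (φ p)
    ... | tri< _ _ _ = iterate f̃ (φ p ∸ ε p) p
    ... | tri≈ _ _ _ = just p
    ... | tri> _ _ _ = iterate ẽ (ε p ∸ φ p) p

{-# OPTIONS --safe #-}

-- Write content r = f r - r for the row lengths f of the partition. The row reaching
-- lowest into column c is the t with f (suc t) ≤ c < f t, and the hook at (r , c) has
-- length content r - (c - t) and arm f r - (c + 1). So balancedness only concerns pairs
-- of congruent integers, a content and a "gap" c - t, on the abacus modulo e.
--
-- The i-signature compares two neighbouring runners, and σ i swaps beads and gaps
-- within some pairs of neighbouring positions. A hook involving a pair that is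
-- not an i-node keeps its condition, possibly moved to the other runner of that pair.
-- For two i-nodes the condition only depends on the signs and on the number g of gaps
-- below the pair modulo d: for - below + it says that g grows by 1, for + below - that
-- g is constant. The reflection turns the unmatched signs +^φ -^ε into +^ε -^φ.
-- The new conditions between a flipped and a matched node follow through the partner
-- of the matched one, and those between two unmatched nodes through a third unmatched
-- node, which exists as soon as both signs occur in the result.

module Submission where

open import Defs
open import Data.Fin using (Fin; toℕ)
open import Data.Fin.Properties using (toℕ<n)
open import Data.Integer as ℤ using (+_; ℤ)
open import Data.Integer.DivMod using (_%ℕ_; _/ℕ_; a≡a%ℕn+[a/ℕn]*n; n%ℕd<d)
import Data.Integer.Divisibility.Signed as ℤ∣
import Data.Integer.Properties as ℤ
open import Data.Integer.Tactic.RingSolver using (solve-∀)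
open import Data.List using (List; []; [_]; _++_; _∷_; _∷ʳ_; _∷ʳ′_; concatMap; downFrom; drop; filter; foldr; head; initLast; last; length; map; take)
open import Data.List.Membership.Propositional using (_∈_; _∉_)
open import Data.List.Membership.Propositional.Properties using (∈-++⁺ʳ; ∈-++⁺ˡ; ∈-++⁻; ∈-downFrom⁺)
open import Data.List.Properties using (++-assoc; concatMap-++; filter-accept; filter-reject; foldr-++; length-++; length-drop; length-map; length-take; take++drop≡id; ∷-injectiveʳ)
open import Data.List.Relation.Unary.All as All using (All; []; _∷_)
import Data.List.Relation.Unary.All.Properties as All
open import Data.List.Relation.Unary.AllPairs using (AllPairs; []; _∷_)
open import Data.List.Relation.Unary.AllPairs.Properties using (applyDownFrom⁺₁)
open import Data.List.Relation.Unary.Any using (here; there)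
open import Data.List.Relation.Unary.Linked using (Linked; [-]; []; _∷_)
open import Data.Maybe using (_>>=_; just)
import Data.Maybe as Maybe
open import Data.Nat using (NonZero; _+_; _<?_; _<_; _>_; _∸_; _≟_; _≤?_; _≤_; _≥_; pred; suc; s≤s; s≤s⁻¹; zero; z≤n; ℕ)
open import Data.Nat.Divisibility using (>⇒∤; ∣1⇒≡1)
open import Data.Nat.Properties using (+-comm; <-asym; <-cmp; <-irrefl; <-trans; <-≤-trans; <⇒≤; <⇒≤pred; <⇒≱; m+n≤o⇒n≤o; m∸[m∸n]≡n; m∸n≡0⇒m≤n; m∸n≤m; m≤n⇒m<n∨m≡n; m≤n⇒m≤1+n; m≤n⇒m⊓n≡m; n≤1+n; pred[n]≤n; ≤-<-trans; ≤-antisym; ≤-refl; ≤-reflexive; ≤-total; ≤-trans; ≤∧≢⇒<; ≮⇒≥; ≰⇒>)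
import Data.Nat.Properties as ℕ
open import Data.Product using (_,_; _×_; proj₁; proj₂; ∃; ∃-syntax; ∃₂)
open import Data.Sum using (_⊎_; inj₁; inj₂)
open import Data.Unit using (tt; ⊤)
open import Relation.Binary.Definitions using (tri<; tri>; tri≈)
open import Relation.Binary.PropositionalEquality using (_≡_; _≢_; cong; cong₂; refl; subst; subst₂; sym; trans)
open import Relation.Nullary using (Dec; contradiction; no; yes; ¬_)
open import Relation.Nullary.Decidable using (_×-dec_)

-- Divisibility of integers and marks of rows

∣-sum : ∀ {k x y z} → k ℤ∣.∣ x → k ℤ∣.∣ y → z ≡ x ℤ.+ y → k ℤ∣.∣ z
∣-sum p q refl = ℤ∣.∣m∣n⇒∣m+n p q

∣-difference : ∀ {k x y z} → k ℤ∣.∣ x → k ℤ∣.∣ y → z ≡ x ℤ.- y → k ℤ∣.∣ z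
∣-difference p q refl = ℤ∣.∣m∣n⇒∣m-n p q

∣-resp : ∀ {k x y} → k ℤ∣.∣ x → y ≡ x → k ℤ∣.∣ y
∣-resp p refl = p

-- The mark of a row: ⊕ if its end carries an addable `i`-node, ⊖ if it carries a removable one, ○
-- if it carries neither.
data Mark : Set where
  ⊕ ⊖ ○ : Mark

allPairs-++⁻ : ∀ {A : Set} {R : A → A → Set} xs {ys} → AllPairs R (xs ++ ys) →
               AllPairs R xs × AllPairs R ys × (∀ {x y} → x ∈ xs → y ∈ ys → R x y)
allPairs-++⁻ []       rs       = [] , rs , λ ()
allPairs-++⁻ (x ∷ xs) (r ∷ rs) with allPairs-++⁻ xs rs
... | rxs , rys , rxy = All.++⁻ˡ xs r ∷ rxs , rys , λ where
  (here refl) y∈ → All.lookup (All.++⁻ʳ xs r) y∈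
  (there x∈)  y∈ → rxy x∈ y∈

-- Bracket matchings of words of marks

-- Matching s L as bs exhibits the bracket matching of the word s over L, ⊖ being
-- the opening and ⊕ the closing bracket; as and bs are the positions of the
-- unmatched ⊕ and ⊖.
data Matching (s : ℕ → Mark) : List ℕ → List ℕ → List ℕ → Set where
  []    : Matching s [] [] []
  skip  : ∀ {r L as bs} → s r ≡ ○ → Matching s L as bs → Matching s (r ∷ L) as bs
  pair  : ∀ {r W a L as bs} → s r ≡ ⊖ → Matching s W [] [] → s a ≡ ⊕ →
          Matching s L as bs → Matching s (r ∷ W ++ a ∷ L) as bs
  closing : ∀ {r L as bs} → s r ≡ ⊕ → Matching s L as bs → Matching s (r ∷ L) (r ∷ as) bs
  opening : ∀ {r L bs} → s r ≡ ⊖ → Matching s L [] bs → Matching s (r ∷ L) [] (r ∷ bs)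

module _ {s : ℕ → Mark} where

  -- A ⊖ put in front of `L` is matched with the first unmatched ⊕. The part `W` before that ⊕ is
  -- fully matched, because a ⊖ left open there would already have been closed by it.
  splitAtClose : ∀ {L a as bs} → Matching s L (a ∷ as) bs →
                 ∃₂ λ W L′ → L ≡ W ++ a ∷ L′ × Matching s W [] [] × s a ≡ ⊕ × Matching s L′ as bs
  splitAtClose (skip {r} sr D) with splitAtClose D
  ... | W , L′ , refl , DW , sa , D′ = r ∷ W , L′ , refl , skip sr DW , sa , D′
  splitAtClose (pair {r} {W} {a} sr DW sa D) with splitAtClose D
  ... | V , L′ , refl , DV , sb , D′ =
    r ∷ W ++ a ∷ V , L′ , cong (r ∷_) (sym (++-assoc W (a ∷ V) _)) , pair sr DW sa DV , sb , D′
  splitAtClose (closing sr D) = [] , _ , refl , [] , sr , D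

  matching : ∀ L → ∃₂ (Matching s L)
  matching [] = _ , _ , []
  matching (r ∷ L) with s r in sr | matching L
  ... | ○ | _ , _ , D = _ , _ , skip sr D
  ... | ⊕ | _ , _ , D = _ , _ , closing sr D
  ... | ⊖ | [] , _ , D = _ , _ , opening sr D
  ... | ⊖ | _ ∷ _ , _ , D with splitAtClose D
  ...   | _ , _ , refl , DW , sa , D′ = _ , _ , pair sr DW sa D′

  all-unmatched : ∀ {P : ℕ → Set} {L as bs} → Matching s L as bs → All P L → All P (as ++ bs)
  all-unmatched []                    _         = []
  all-unmatched (skip _ D)            (_ ∷ ps)  = all-unmatched D ps
  all-unmatched (pair {W = W} _ _ _ D) (_ ∷ ps) with All.++⁻ʳ W ps
  ... | _ ∷ qs = all-unmatched D qs
  all-unmatched (closing _ D)           (p ∷ ps)  = p ∷ all-unmatched D ps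
  all-unmatched (opening _ D)           (p ∷ ps)  = p ∷ all-unmatched D ps

  allPairs-unmatched : ∀ {R : ℕ → ℕ → Set} {L as bs} → Matching s L as bs →
                       AllPairs R L → AllPairs R (as ++ bs)
  allPairs-unmatched []                    _         = []
  allPairs-unmatched (skip _ D)            (_ ∷ ps)  = allPairs-unmatched D ps
  allPairs-unmatched (pair {W = W} _ _ _ D) (_ ∷ ps) with allPairs-++⁻ W ps
  ... | _ , (_ ∷ qs) , _ = allPairs-unmatched D qs
  allPairs-unmatched (closing _ D)           (p ∷ ps)  = all-unmatched D p ∷ allPairs-unmatched D ps
  allPairs-unmatched (opening _ D)           (p ∷ ps)  = all-unmatched D p ∷ allPairs-unmatched D ps

  unmatched-⊆ : ∀ {L as bs} → Matching s L as bs → ∀ {u} → u ∈ as ++ bs → u ∈ L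
  unmatched-⊆ {L} D = All.lookup (all-unmatched D (All.tabulate {xs = L} (λ x∈ → x∈)))

  unmatched-⊕ : ∀ {L as bs} → Matching s L as bs → ∀ {u} → u ∈ as → s u ≡ ⊕
  unmatched-⊕ (skip _ D)     u∈          = unmatched-⊕ D u∈
  unmatched-⊕ (pair _ _ _ D) u∈          = unmatched-⊕ D u∈
  unmatched-⊕ (closing sr _)   (here refl) = sr
  unmatched-⊕ (closing _ D)    (there u∈)  = unmatched-⊕ D u∈

  unmatched-⊖ : ∀ {L as bs} → Matching s L as bs → ∀ {u} → u ∈ bs → s u ≡ ⊖
  unmatched-⊖ (skip _ D)     u∈          = unmatched-⊖ D u∈
  unmatched-⊖ (pair _ _ _ D) u∈          = unmatched-⊖ D u∈
  unmatched-⊖ (closing _ D)    u∈          = unmatched-⊖ D u∈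
  unmatched-⊖ (opening sr _)   (here refl) = sr
  unmatched-⊖ (opening _ D)    (there u∈)  = unmatched-⊖ D u∈

  -- The last clause says that no unmatched ⊕ lies between x and its partner.
  partner-⊕ : ∀ {L as bs} → Matching s L as bs → AllPairs _>_ L → ∀ {x} → x ∈ L → s x ≡ ⊕ →
              x ∈ as ⊎ ∃ λ m → m ∈ L × s m ≡ ⊖ × x < m × (∀ {u} → u ∈ as → x < u → m < u)
  partner-⊕ (skip sr D) (_ ∷ _) (here refl) sx with () ← trans (sym sr) sx
  partner-⊕ (skip sr D) (_ ∷ ps) (there x∈) sx with partner-⊕ D ps x∈ sx
  ... | inj₁ x∈as = inj₁ x∈as
  ... | inj₂ (m , m∈ , rest) = inj₂ (m , there m∈ , rest)
  partner-⊕ (pair sr _ _ D) ps (here refl) sx with () ← trans (sym sr) sx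
  partner-⊕ (pair {r} {W} {a} {L} sr DW sa D) (p ∷ ps) (there x∈) sx
    with allPairs-++⁻ W ps | ∈-++⁻ W x∈
  ... | pW , _ , W>aL | inj₁ x∈W with partner-⊕ DW pW x∈W sx
  ...   | inj₂ (m , m∈ , sm , x<m , _) = inj₂ (m , there (∈-++⁺ˡ m∈) , sm , x<m ,
          λ u∈ x<u → contradiction x<u (<-asym (W>aL x∈W (there (unmatched-⊆ D (∈-++⁺ˡ u∈))))))
  partner-⊕ (pair {r} {W} {a} {L} sr DW sa D) (p ∷ ps) (there x∈) sx
      | _ , (a>L ∷ _) , _ | inj₂ (here refl) = inj₂ (r , here refl , sr , All.lookup p x∈ ,
          λ u∈ x<u → contradiction x<u (<-asym (All.lookup a>L (unmatched-⊆ D (∈-++⁺ˡ u∈)))))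
  partner-⊕ (pair {r} {W} {a} {L} sr DW sa D) (p ∷ ps) (there x∈) sx
      | _ , (_ ∷ pL) , _ | inj₂ (there x∈L) with partner-⊕ D pL x∈L sx
  ...   | inj₁ x∈as = inj₁ x∈as
  ...   | inj₂ (m , m∈ , rest) = inj₂ (m , there (∈-++⁺ʳ W (there m∈)) , rest)
  partner-⊕ (closing sr D) (p ∷ ps) (here refl) sx = inj₁ (here refl)
  partner-⊕ (closing sr D) (p ∷ ps) (there x∈)  sx with partner-⊕ D ps x∈ sx
  ... | inj₁ x∈as = inj₁ (there x∈as)
  ... | inj₂ (m , m∈ , sm , x<m , outside) = inj₂ (m , there m∈ , sm , x<m , λ where
    (here refl) _   → All.lookup p m∈
    (there u∈)  x<u → outside u∈ x<u)
  partner-⊕ (opening sr D) (p ∷ ps) (here refl) sx with () ← trans (sym sr) sx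
  partner-⊕ (opening sr D) (p ∷ ps) (there x∈) sx with partner-⊕ D ps x∈ sx
  ... | inj₂ (m , m∈ , sm , x<m , _) = inj₂ (m , there m∈ , sm , x<m , λ ())

  -- Unmatched positions lie outside every matched pair, which gives the last clause: an unmatched ⊖
  -- above `x` is also above the partner of `x`.
  partner-⊖ : ∀ {L as bs} → Matching s L as bs → AllPairs _>_ L → ∀ {x} → x ∈ L → s x ≡ ⊖ →
              x ∈ bs ⊎ ∃ λ m → m ∈ L × s m ≡ ⊕ × m < x × (∀ {u} → u ∈ bs → u < x → u < m)
  partner-⊖ (skip sr D) (_ ∷ _) (here refl) sx with () ← trans (sym sr) sx
  partner-⊖ (skip sr D) (_ ∷ ps) (there x∈) sx with partner-⊖ D ps x∈ sx
  ... | inj₁ x∈bs = inj₁ x∈bs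
  ... | inj₂ (m , m∈ , rest) = inj₂ (m , there m∈ , rest)
  partner-⊖ (pair {r} {W} {a} {L} {as} sr _ sa D) (p ∷ ps) (here refl) sx with allPairs-++⁻ W ps
  ... | _ , (a>L ∷ _) , _ = inj₂ (a , there a∈ , sa , All.lookup p a∈ ,
          λ u∈ _ → All.lookup a>L (unmatched-⊆ D (∈-++⁺ʳ as u∈)))
    where a∈ = ∈-++⁺ʳ W (here refl)
  partner-⊖ (pair {r} {W} {a} {L} {as} sr DW sa D) (p ∷ ps) (there x∈) sx
    with allPairs-++⁻ W ps | ∈-++⁻ W x∈
  ... | pW , _ , W>aL | inj₁ x∈W with partner-⊖ DW pW x∈W sx
  ...   | inj₂ (m , m∈ , sm , m<x , _) = inj₂ (m , there (∈-++⁺ˡ m∈) , sm , m<x ,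
          λ u∈ _ → W>aL m∈ (there (unmatched-⊆ D (∈-++⁺ʳ as u∈))))
  partner-⊖ (pair {r} {W} {a} {L} sr DW sa D) (p ∷ ps) (there x∈) sx
      | _ | inj₂ (here refl) with () ← trans (sym sa) sx
  partner-⊖ (pair {r} {W} {a} {L} sr DW sa D) (p ∷ ps) (there x∈) sx
      | _ , (_ ∷ pL) , _ | inj₂ (there x∈L) with partner-⊖ D pL x∈L sx
  ...   | inj₁ x∈bs = inj₁ x∈bs
  ...   | inj₂ (m , m∈ , rest) = inj₂ (m , there (∈-++⁺ʳ W (there m∈)) , rest)
  partner-⊖ (closing sr D) (p ∷ ps) (here refl) sx with () ← trans (sym sr) sx
  partner-⊖ (closing sr D) (p ∷ ps) (there x∈)  sx with partner-⊖ D ps x∈ sx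
  ... | inj₁ x∈bs = inj₁ x∈bs
  ... | inj₂ (m , m∈ , rest) = inj₂ (m , there m∈ , rest)
  partner-⊖ (opening sr D) (p ∷ ps) (here refl) sx = inj₁ (here refl)
  partner-⊖ (opening sr D) (p ∷ ps) (there x∈) sx with partner-⊖ D ps x∈ sx
  ... | inj₁ x∈bs = inj₁ (there x∈bs)
  ... | inj₂ (m , m∈ , sm , m<x , outside) = inj₂ (m , there m∈ , sm , m<x , λ where
    (here refl) u<x → contradiction u<x (<-asym (All.lookup p x∈))
    (there u∈)  u<x → outside u∈ u<x)

module _ {s s′ : ℕ → Mark} where

  matching-cong : ∀ {L as bs} → (∀ {r} → r ∈ L → s′ r ≡ s r) → Matching s L as bs → Matching s′ L as bs
  matching-cong eq []              = []
  matching-cong eq (skip sr D)     = skip (trans (eq (here refl)) sr) (matching-cong (λ r∈ → eq (there r∈)) D)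
  matching-cong eq (pair {W = W} sr DW sa D) =
    pair (trans (eq (here refl)) sr)
         (matching-cong (λ r∈ → eq (there (∈-++⁺ˡ r∈))) DW)
         (trans (eq (there (∈-++⁺ʳ W (here refl)))) sa)
         (matching-cong (λ r∈ → eq (there (∈-++⁺ʳ W (there r∈)))) D)
  matching-cong eq (closing sr D)    = closing (trans (eq (here refl)) sr) (matching-cong (λ r∈ → eq (there r∈)) D)
  matching-cong eq (opening sr D)    = opening (trans (eq (here refl)) sr) (matching-cong (λ r∈ → eq (there r∈)) D)

  private
    ≢-head : ∀ {ρ r : ℕ} {L} → All (_>_ ρ) L → r ∈ L → r ≢ ρ
    ≢-head p r∈ refl = <-irrefl refl (All.lookup p r∈)

    ≢-tail : ∀ {ρ r : ℕ} {L} → All (_>_ r) L → ρ ∈ L → r ≢ ρ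
    ≢-tail p ρ∈ refl = <-irrefl refl (All.lookup p ρ∈)

  module _ {ρ : ℕ} (eq : ∀ {r} → r ≢ ρ → s′ r ≡ s r) where

    -- No unmatched ⊕ follows the last one, so the ⊖ that replaces it stays unmatched and precedes
    -- all of `bs`; the matched pairs do not change. This is the effect of one step of `f̃`.
    matching-⊕→⊖ : s′ ρ ≡ ⊖ → ∀ as {L bs} → Matching s L (as ∷ʳ ρ) bs → AllPairs _>_ L →
                   Matching s′ L as (ρ ∷ bs)
    matching-⊕→⊖ s′ρ as D = go as refl D
      where
      ρ∈ : ∀ as {xs L bs} → xs ≡ as ∷ʳ ρ → Matching s L xs bs → ρ ∈ L
      ρ∈ as refl D = unmatched-⊆ D (∈-++⁺ˡ (∈-++⁺ʳ as (here refl)))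
      go : ∀ as {xs L bs} → xs ≡ as ∷ʳ ρ → Matching s L xs bs → AllPairs _>_ L → Matching s′ L as (ρ ∷ bs)
      go as xs≡ (skip sr D) (p ∷ ps) = skip (trans (eq (≢-tail p (ρ∈ as xs≡ D))) sr) (go as xs≡ D ps)
      go as xs≡ (pair {W = W} sr DW sa D) (p ∷ ps) with allPairs-++⁻ W ps
      ... | _ , (q ∷ qs) , W>aL =
        pair (trans (eq (≢-tail p (∈-++⁺ʳ W (there (ρ∈ as xs≡ D))))) sr)
             (matching-cong (λ r∈ → eq λ { refl → <-irrefl refl (W>aL r∈ (there (ρ∈ as xs≡ D))) }) DW)
             (trans (eq (≢-tail q (ρ∈ as xs≡ D))) sa)
             (go as xs≡ D qs)
      go []       ()   []
      go (_ ∷ _)  ()   []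
      go []       ()   (opening _ _)
      go (_ ∷ _)  ()   (opening _ _)
      go []       refl (closing sr D) (p ∷ ps) = opening s′ρ (matching-cong (λ r∈ → eq (≢-head p r∈)) D)
      go (_ ∷ as) refl (closing sr D) (p ∷ ps) = closing (trans (eq (≢-tail p (ρ∈ as refl D))) sr) (go as refl D ps)

    -- No bracket is left open before the first unmatched ⊖, so the ⊕ that replaces it finds no
    -- partner. This is the effect of one step of `ẽ`.
    matching-⊖→⊕ : s′ ρ ≡ ⊕ → ∀ {L as bs} → Matching s L as (ρ ∷ bs) → AllPairs _>_ L →
                   Matching s′ L (as ∷ʳ ρ) bs
    matching-⊖→⊕ s′ρ = go
      where
      ρ∈ : ∀ {L as bs} → Matching s L as (ρ ∷ bs) → ρ ∈ L
      ρ∈ {as = as} D = unmatched-⊆ D (∈-++⁺ʳ as (here refl))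
      go : ∀ {L as bs} → Matching s L as (ρ ∷ bs) → AllPairs _>_ L → Matching s′ L (as ∷ʳ ρ) bs
      go (skip sr D) (p ∷ ps) = skip (trans (eq (≢-tail p (ρ∈ D))) sr) (go D ps)
      go (pair {W = W} sr DW sa D) (p ∷ ps) with allPairs-++⁻ W ps
      ... | _ , (q ∷ qs) , W>aL =
        pair (trans (eq (≢-tail p (∈-++⁺ʳ W (there (ρ∈ D))))) sr)
             (matching-cong (λ r∈ → eq λ { refl → <-irrefl refl (W>aL r∈ (there (ρ∈ D))) }) DW)
             (trans (eq (≢-tail q (ρ∈ D))) sa)
             (go D qs)
      go (closing sr D) (p ∷ ps) = closing (trans (eq (≢-tail p (ρ∈ D))) sr) (go D ps)
      go (opening sr D) (p ∷ ps) = closing s′ρ (matching-cong (λ r∈ → eq (≢-head p r∈)) D)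

-- Compatibility of marks and its preservation under flips

Compatible : ℤ → Mark → Mark → ℤ → Set
Compatible d ⊖ ⊕ x = d ℤ∣.∣ x ℤ.- + 1
Compatible d ⊕ ⊖ x = d ℤ∣.∣ x
Compatible d _ _ _ = ⊤

-- Row `j` lies below row `k`, so the first mark passed to `Compatible` is the lower one. On the
-- abacus ⊕ is a bead followed by a gap and ⊖ a gap followed by a bead. For equal marks the gap of
-- the lower pair and the bead of the upper pair are on different runners, so no condition arises.
Admissible : ℤ → (ℕ → ℤ) → (ℕ → Mark) → Set
Admissible d g s = ∀ {j k} → k < j → Compatible d (s j) (s k) (g k ℤ.- g j)

module _ {d : ℤ} (g : ℕ → ℤ) {s : ℕ → Mark} (adm : Admissible d g s) {j k : ℕ} (k<j : k < j) where

  admissible-⊖⊕ : s j ≡ ⊖ → s k ≡ ⊕ → d ℤ∣.∣ g k ℤ.- g j ℤ.- + 1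
  admissible-⊖⊕ sj sk = subst₂ (λ m n → Compatible d m n (g k ℤ.- g j)) sj sk (adm k<j)

  admissible-⊕⊖ : s j ≡ ⊕ → s k ≡ ⊖ → d ℤ∣.∣ g k ℤ.- g j
  admissible-⊕⊖ sj sk = subst₂ (λ m n → Compatible d m n (g k ℤ.- g j)) sj sk (adm k<j)

∈-equinumerous : ∀ {x : ℕ} {xs ys : List ℕ} → length xs ≡ length ys → x ∈ xs → ∃ λ y → y ∈ ys
∈-equinumerous {xs = _ ∷ _} {ys = y ∷ _} _ _ = y , here refl

module _ {d : ℤ} {g : ℕ → ℤ} {s s′ : ℕ → Mark} {L : List ℕ}
         (L> : AllPairs _>_ L) (marked : ∀ {r} → s r ≢ ○ → r ∈ L) (adm : Admissible d g s) where

  private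
    ∈L : ∀ {r m} → s r ≡ m → m ≢ ○ → r ∈ L
    ∈L refl m≢○ = marked m≢○

  -- The uppermost unmatched ⊕, those in `F`, turn into ⊖. A condition is new only between a row of
  -- `F` and a row that keeps its ⊕, and it results from two old conditions involving a third row.
  -- The equality of lengths provides an unmatched ⊖ whenever an unmatched ⊕ is kept.
  admissible-⊕→⊖ : ∀ as₁ {F bs} → Matching s L (as₁ ++ F) bs → length as₁ ≡ length bs →
                   (∀ r → (r ∈ F × s′ r ≡ ⊖) ⊎ (r ∉ F × s′ r ≡ s r)) → Admissible d g s′
  admissible-⊕→⊖ as₁ {F} {bs} D len flip {j} {k} k<j with flip j | flip k
  ... | inj₁ (_ , s′j) | inj₁ (_ , s′k) rewrite s′j | s′k = tt
  ... | inj₂ (_ , s′j) | inj₂ (_ , s′k) rewrite s′j | s′k = adm k<j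
  ... | inj₁ (j∈ , s′j) | inj₂ (k∉ , s′k) rewrite s′j | s′k with s k in sk
  ...   | ○ = tt
  ...   | ⊖ = tt
  ...   | ⊕ with partner-⊕ D L> (∈L sk λ ()) sk
  ...     | inj₁ k∈ with ∈-++⁻ as₁ k∈
  ...       | inj₂ k∈F = contradiction k∈F k∉
  ...       | inj₁ k∈as₁ = contradiction k<j (<-asym (as₁>F k∈as₁ j∈))
    where as₁>F = proj₂ (proj₂ (allPairs-++⁻ as₁ (proj₁ (allPairs-++⁻ (as₁ ++ F) (allPairs-unmatched D L>)))))
  -- Being unmatched, `j` is outside the pair of `k` and its partner `m`, so `m` lies between `k`
  -- and `j`. Modulo `d` the level is constant from `j` to `m` and grows by 1 from `m` to `k`.
  admissible-⊕→⊖ as₁ D len flip {j} {k} k<j | inj₁ (j∈ , s′j) | inj₂ (k∉ , s′k)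
      | ⊕ | inj₂ (m , _ , sm , k<m , outside) =
    ∣-sum (admissible-⊖⊕ g adm k<m sm sk) (admissible-⊕⊖ g adm (outside (∈-++⁺ʳ as₁ j∈) k<j) (unmatched-⊕ D (∈-++⁺ʳ as₁ j∈)) sm)
          (telescope (g j) (g k) (g m))
    where telescope : ∀ x y z → y ℤ.- x ℤ.- + 1 ≡ (y ℤ.- z ℤ.- + 1) ℤ.+ (z ℤ.- x)
          telescope = solve-∀
  admissible-⊕→⊖ as₁ {F} {bs} D len flip {j} {k} k<j | inj₂ (j∉ , s′j) | inj₁ (k∈ , s′k) rewrite s′j | s′k with s j in sj
  ... | ○ = tt
  ... | ⊖ = tt
  ... | ⊕ with partner-⊕ D L> (∈L sj λ ()) sj
  -- Both `j` and `k` were ⊕ above the ⊖ in row `m`, so both levels exceed that of `m` by 1 modulo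
  -- `d`.
  ...   | inj₂ (m , _ , sm , j<m , _) =
    ∣-difference (admissible-⊖⊕ g adm (<-trans k<j j<m) sm (unmatched-⊕ D (∈-++⁺ʳ as₁ k∈))) (admissible-⊖⊕ g adm j<m sm sj)
                 (telescope (g j) (g k) (g m))
    where telescope : ∀ x y z → y ℤ.- x ≡ (y ℤ.- z ℤ.- + 1) ℤ.- (x ℤ.- z ℤ.- + 1)
          telescope = solve-∀
  ...   | inj₁ j∈ with ∈-++⁻ as₁ j∈
  ...     | inj₂ j∈F = contradiction j∈F j∉
  ...     | inj₁ j∈as₁ with ∈-equinumerous len j∈as₁
  -- As `as₁` contains `j`, there is an unmatched ⊖ in some row `b`. It lies above both rows, whose
  -- levels therefore agree with its level modulo `d`.
  ...       | b , b∈ =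
    ∣-difference (admissible-⊕⊖ g adm (as>bs j∈ b∈) sj (unmatched-⊖ D b∈))
                 (admissible-⊕⊖ g adm (as>bs (∈-++⁺ʳ as₁ k∈) b∈) (unmatched-⊕ D (∈-++⁺ʳ as₁ k∈)) (unmatched-⊖ D b∈))
                 (telescope (g j) (g k) (g b))
    where as>bs = proj₂ (proj₂ (allPairs-++⁻ (as₁ ++ F) (allPairs-unmatched D L>)))
          telescope : ∀ x y z → y ℤ.- x ≡ (z ℤ.- x) ℤ.- (z ℤ.- y)
          telescope = solve-∀

  -- The mirror image for lowering: `F` consists of the lowest unmatched ⊖, and the third row
  -- carries a ⊕. It is the partner of the kept ⊖ or, if that is unmatched, an unmatched ⊕ provided
  -- by the equality of lengths.
  admissible-⊖→⊕ : ∀ {as} F {bs₂} → Matching s L as (F ++ bs₂) → length bs₂ ≡ length as →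
                   (∀ r → (r ∈ F × s′ r ≡ ⊕) ⊎ (r ∉ F × s′ r ≡ s r)) → Admissible d g s′
  admissible-⊖→⊕ {as} F {bs₂} D len flip {j} {k} k<j with flip j | flip k
  ... | inj₁ (_ , s′j) | inj₁ (_ , s′k) rewrite s′j | s′k = tt
  ... | inj₂ (_ , s′j) | inj₂ (_ , s′k) rewrite s′j | s′k = adm k<j
  ... | inj₂ (j∉ , s′j) | inj₁ (k∈ , s′k) rewrite s′j | s′k with s j in sj
  ...   | ○ = tt
  ...   | ⊕ = tt
  ...   | ⊖ with partner-⊖ D L> (∈L sj λ ()) sj
  ...     | inj₂ (m , _ , sm , m<j , outside) =
    ∣-sum (admissible-⊖⊕ g adm m<j sj sm) (admissible-⊕⊖ g adm (outside (∈-++⁺ˡ k∈) k<j) sm (unmatched-⊖ D (∈-++⁺ˡ k∈)))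
          (telescope (g j) (g k) (g m))
    where telescope : ∀ x y z → y ℤ.- x ℤ.- + 1 ≡ (z ℤ.- x ℤ.- + 1) ℤ.+ (y ℤ.- z)
          telescope = solve-∀
  ...     | inj₁ j∈ with ∈-++⁻ F j∈
  ...       | inj₁ j∈F = contradiction j∈F j∉
  ...       | inj₂ j∈bs₂ = contradiction k<j (<-asym (F>bs₂ k∈ j∈bs₂))
    where F>bs₂ = proj₂ (proj₂ (allPairs-++⁻ F (proj₁ (proj₂ (allPairs-++⁻ as (allPairs-unmatched D L>))))))
  admissible-⊖→⊕ {as} F D len flip {j} {k} k<j | inj₁ (j∈ , s′j) | inj₂ (k∉ , s′k) rewrite s′j | s′k with s k in sk
  ... | ○ = tt
  ... | ⊕ = tt
  ... | ⊖ with partner-⊖ D L> (∈L sk λ ()) sk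
  ...   | inj₂ (m , _ , sm , m<k , _) =
    ∣-difference (admissible-⊖⊕ g adm (<-trans m<k k<j) (unmatched-⊖ D (∈-++⁺ˡ j∈)) sm) (admissible-⊖⊕ g adm m<k sk sm)
                 (telescope (g j) (g k) (g m))
    where telescope : ∀ x y z → y ℤ.- x ≡ (z ℤ.- x ℤ.- + 1) ℤ.- (z ℤ.- y ℤ.- + 1)
          telescope = solve-∀
  ...   | inj₁ k∈ with ∈-++⁻ F k∈
  ...     | inj₁ k∈F = contradiction k∈F k∉
  ...     | inj₂ k∈bs₂ with ∈-equinumerous len k∈bs₂
  ...       | a , a∈ =
    ∣-difference (admissible-⊕⊖ g adm (as>bs a∈ k∈) (unmatched-⊕ D a∈) sk)
                 (admissible-⊕⊖ g adm (as>bs a∈ (∈-++⁺ˡ j∈)) (unmatched-⊕ D a∈) (unmatched-⊖ D (∈-++⁺ˡ j∈)))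
                 (telescope (g j) (g k) (g a))
    where as>bs = proj₂ (proj₂ (allPairs-++⁻ as (allPairs-unmatched D L>)))
          telescope : ∀ x y z → y ℤ.- x ≡ (y ℤ.- z) ℤ.- (x ℤ.- z)
          telescope = solve-∀

-- Row length functions and the abacus

Mono : (ℕ → ℕ) → Set
Mono f = ∀ r → f (suc r) ≤ f r

mono-≤ : ∀ {f} → Mono f → ∀ {r t} → r ≤ t → f t ≤ f r
mono-≤ mono {r} {t} r≤t with m≤n⇒m<n∨m≡n r≤t
... | inj₂ refl = ≤-refl
mono-≤ mono {r} {suc t} _ | inj₁ r<t = ≤-trans (mono t) (mono-≤ mono (s≤s⁻¹ r<t))

mono-< : ∀ {f} → Mono f → ∀ {r t} → f t < f r → r < t
mono-< mono {r} {t} ft<fr with t ≤? r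
... | yes t≤r = contradiction (<-≤-trans ft<fr (mono-≤ mono t≤r)) (<-irrefl refl)
... | no t≰r = ≰⇒> t≰r

<⇒suc : ∀ {m n} → m < n → ∃ λ c → n ≡ suc c × m ≤ c
<⇒suc (s≤s m≤c) = _ , refl , m≤c

content : (ℕ → ℕ) → ℕ → ℤ
content f r = + f r ℤ.- + r

-- In a column c the lowest row t reaching it is determined by f (suc t) ≤ c < f t,
-- so that the hook at (r , c) has length (f r - r) - (c - t) and arm f r - (c + 1).
BalancedRows : (d e : ℤ) → (ℕ → ℕ) → Set
BalancedRows d e f = ∀ r t c → c < f r → c < f t → f (suc t) ≤ c →
                     e ℤ∣.∣ content f r ℤ.- (+ c ℤ.- + t) → d ℤ∣.∣ + f r ℤ.- + suc c

-- For a partition this means that row `r` has an addable node, which the top row always has.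
Indented : (ℕ → ℕ) → ℕ → Set
Indented f zero    = ⊤
Indented f (suc r) = f (suc r) < f r

indented? : ∀ f r → Dec (Indented f r)
indented? f zero    = yes tt
indented? f (suc r) = f (suc r) <? f r

-- Signs of rows and the effect of adding one node

module Signs (e : ℕ) (1<e : 1 < e) (ι : ℤ) where

  -- `content f r` is the content of the node just after the end of row `r`; the removable node is
  -- the one before it, which accounts for the `+ 1`.
  Plus Minus : (ℕ → ℕ) → ℕ → Set
  Plus  f r = Indented f r × + e ℤ∣.∣ content f r ℤ.- ι
  Minus f r = f (suc r) < f r × + e ℤ∣.∣ content f r ℤ.- + 1 ℤ.- ι

  plus? : ∀ f r → Dec (Plus f r)
  plus? f r = indented? f r ×-dec (+ e ℤ∣.∣? _)

  minus? : ∀ f r → Dec (Minus f r)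
  minus? f r = (f (suc r) <? f r) ×-dec (+ e ℤ∣.∣? _)

  sign : (ℕ → ℕ) → ℕ → Mark
  sign f r with plus? f r | minus? f r
  ... | yes _ | _     = ⊕
  ... | no  _ | yes _ = ⊖
  ... | no  _ | no  _ = ○

  -- Since `1 < e`, two nodes with consecutive contents never have the same residue. This excludes
  -- the degenerate configurations below.
  ∤-consecutive : ∀ {x y} → + e ℤ∣.∣ x → + e ℤ∣.∣ y → ¬ + 1 ≡ x ℤ.- y
  ∤-consecutive p q eq with ∣1⇒≡1 (ℤ∣.∣⇒∣ᵤ (∣-difference p q eq))
  ... | refl = <-irrefl refl 1<e

  plus-minus-disjoint : ∀ {f r} → Plus f r → ¬ Minus f r
  plus-minus-disjoint {f} {r} (_ , p) (_ , q) = ∤-consecutive p q (eq (content f r) ι)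
    where eq : ∀ x y → + 1 ≡ (x ℤ.- y) ℤ.- (x ℤ.- + 1 ℤ.- y)
          eq = solve-∀

  sign-⊕ : ∀ {f r} → Plus f r → sign f r ≡ ⊕
  sign-⊕ {f} {r} p with plus? f r
  ... | yes _ = refl
  ... | no ¬p = contradiction p ¬p

  sign-⊖ : ∀ {f r} → Minus f r → sign f r ≡ ⊖
  sign-⊖ {f} {r} m with plus? f r | minus? f r
  ... | yes p | _     = contradiction m (plus-minus-disjoint {f} {r} p)
  ... | no _  | yes _ = refl
  ... | no _  | no ¬m = contradiction m ¬m

  sign-○ : ∀ {f r} → ¬ Plus f r → ¬ Minus f r → sign f r ≡ ○
  sign-○ {f} {r} ¬p ¬m with plus? f r | minus? f r
  ... | yes p | _     = contradiction p ¬p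
  ... | no _  | yes m = contradiction m ¬m
  ... | no _  | no _  = refl

  sign-⊕⁻ : ∀ {f r} → sign f r ≡ ⊕ → Plus f r
  sign-⊕⁻ {f} {r} eq with plus? f r | minus? f r
  sign-⊕⁻ _  | yes p | _     = p
  sign-⊕⁻ () | no _  | yes _
  sign-⊕⁻ () | no _  | no _

  sign-⊖⁻ : ∀ {f r} → sign f r ≡ ⊖ → Minus f r
  sign-⊖⁻ {f} {r} eq with plus? f r | minus? f r
  sign-⊖⁻ () | yes _ | _
  sign-⊖⁻ _  | no _  | yes m = m
  sign-⊖⁻ () | no _  | no _

  sign-cong : ∀ {f g r} → (Plus f r → Plus g r) → (Plus g r → Plus f r) →
              (Minus f r → Minus g r) → (Minus g r → Minus f r) → sign g r ≡ sign f r
  sign-cong {f} {g} {r} p p⁻ m m⁻ with plus? f r | minus? f r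
  ... | yes q | _     = sign-⊕ {g} (p q)
  ... | no ¬q | yes n = sign-⊖ {g} (m n)
  ... | no ¬q | no ¬n = sign-○ {g} (λ q → ¬q (p⁻ q)) (λ n → ¬n (m⁻ n))

  -- One relation serves both directions: the larger row lengths `f′` are the new ones for `f̃` and
  -- the old ones for `ẽ`.
  data Step (F : List ℕ) (f f′ : ℕ → ℕ) (r : ℕ) : Set where
    raised : r ∈ F → sign f r ≡ ⊕ → sign f′ r ≡ ⊖ → f′ r ≡ suc (f r) → Step F f f′ r
    kept   : r ∉ F → sign f′ r ≡ sign f r → f′ r ≡ f r → Step F f f′ r

  weight : Mark → ℤ
  weight ⊖ = + 1
  weight _ = + 0

  -- On the abacus whose beads are the contents of the rows, this counts the gaps
  -- below the pair of positions in which the end of row r lies, so that moving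
  -- a bead within its pair does not change it.
  level : (ℕ → ℕ) → ℕ → ℤ
  level f r = + f r ℤ.- weight (sign f r)

  level-⊕ : ∀ {f r} → sign f r ≡ ⊕ → level f r ≡ + f r
  level-⊕ {f} {r} eq rewrite eq = x-0≡x (+ f r)
    where x-0≡x : ∀ x → x ℤ.- + 0 ≡ x
          x-0≡x = solve-∀

  level-⊖ : ∀ {f r} → sign f r ≡ ⊖ → level f r ≡ + f r ℤ.- + 1
  level-⊖ eq rewrite eq = refl

  level-step : ∀ {F f f′ r} → Step F f f′ r → level f′ r ≡ level f r
  level-step {f = f} {f′} {r} (raised _ sr s′r eq) =
    trans (level-⊖ {f′} s′r) (trans (trans (cong (λ n → + n ℤ.- + 1) eq) (suc-pred (+ f r))) (sym (level-⊕ {f} sr)))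
    where suc-pred : ∀ x → (+ 1 ℤ.+ x) ℤ.- + 1 ≡ x
          suc-pred = solve-∀
  level-step (kept _ sr eq) = cong₂ (λ n m → + n ℤ.- weight m) eq sr

  module _ {f f′ ρ} (mono : Mono f) (mono′ : Mono f′) (f′ρ : f′ ρ ≡ suc (f ρ))
           (f′r : ∀ {r} → r ≢ ρ → f′ r ≡ f r) (e∣ : + e ℤ∣.∣ content f ρ ℤ.- ι) where

    private
      raises : ∀ r → f r ≤ f′ r
      raises r with r ≟ ρ
      ... | yes refl = ≤-trans (n≤1+n _) (≤-reflexive (sym f′ρ))
      ... | no r≢ρ   = ≤-reflexive (sym (f′r r≢ρ))

    raise-⊕ : sign f ρ ≡ ⊕
    raise-⊕ = sign-⊕ {f} {ρ} (indented ρ refl , e∣)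
      where
      indented : ∀ r → r ≡ ρ → Indented f r
      indented zero    _    = tt
      indented (suc r) refl = subst₂ _≤_ f′ρ (f′r λ r≡ → <-irrefl r≡ ≤-refl) (mono′ r)

    raise-⊖ : sign f′ ρ ≡ ⊖
    raise-⊖ = sign-⊖ {f′} {ρ}
      ( subst₂ _<_ (sym (f′r λ r≡ → <-irrefl (sym r≡) ≤-refl)) (sym f′ρ) (s≤s (mono ρ))
      , ∣-resp e∣ (trans (cong (λ n → (+ n ℤ.- + ρ) ℤ.- + 1 ℤ.- ι) f′ρ) (shift (+ f ρ) (+ ρ) ι)))
      where shift : ∀ x y z → ((+ 1 ℤ.+ x) ℤ.- y) ℤ.- + 1 ℤ.- z ≡ (x ℤ.- y) ℤ.- z
            shift = solve-∀

    -- The new node can only make the next row indented, or destroy the descent of the row above.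
    -- The addable or removable node concerned is then directly below or above the new one, so its
    -- content differs by 1 and it has another residue.
    raise-kept : ∀ {r} → r ≢ ρ → sign f′ r ≡ sign f r
    raise-kept {r} r≢ρ = sign-cong {f} {f′} {r}
      (λ (i , q) → indented r r≢ρ i , congruence q)
      (λ (i , q) → indented⁻ r r≢ρ i (congruence⁻ q) , congruence⁻ q)
      (λ (i , q) → removable i q , ∣-resp q (cong (λ n → (+ n ℤ.- + r) ℤ.- + 1 ℤ.- ι) (f′r r≢ρ)))
      (λ (i , q) → ≤-<-trans (raises (suc r)) (subst (f′ (suc r) <_) (f′r r≢ρ) i)
                 , ∣-resp q (cong (λ n → (+ n ℤ.- + r) ℤ.- + 1 ℤ.- ι) (sym (f′r r≢ρ))))
      where
      congruence : + e ℤ∣.∣ content f r ℤ.- ι → + e ℤ∣.∣ content f′ r ℤ.- ι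
      congruence q = ∣-resp q (cong (λ n → (+ n ℤ.- + r) ℤ.- ι) (f′r r≢ρ))
      congruence⁻ : + e ℤ∣.∣ content f′ r ℤ.- ι → + e ℤ∣.∣ content f r ℤ.- ι
      congruence⁻ q = ∣-resp q (cong (λ n → (+ n ℤ.- + r) ℤ.- ι) (sym (f′r r≢ρ)))
      indented : ∀ r → r ≢ ρ → Indented f r → Indented f′ r
      indented zero    _   _ = tt
      indented (suc r) r≢ρ i = subst (_< f′ r) (sym (f′r r≢ρ)) (<-≤-trans i (raises r))
      indented⁻ : ∀ r → r ≢ ρ → Indented f′ r → + e ℤ∣.∣ content f r ℤ.- ι → Indented f r
      indented⁻ zero    _   _ _ = tt
      indented⁻ (suc r) r≢ρ i q with r ≟ ρ
      ... | no r₀≢ρ = subst₂ _<_ (f′r r≢ρ) (f′r r₀≢ρ) i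
      ... | yes refl = ≤∧≢⇒< (mono r) λ eq →
        ∤-consecutive e∣ q (trans (consecutive (+ f r) (+ r) ι)
          (cong (λ n → (+ f r ℤ.- + r ℤ.- ι) ℤ.- (+ n ℤ.- + suc r ℤ.- ι)) (sym eq)))
        where consecutive : ∀ x y z → + 1 ≡ (x ℤ.- y ℤ.- z) ℤ.- (x ℤ.- (+ 1 ℤ.+ y) ℤ.- z)
              consecutive = solve-∀
      removable : f (suc r) < f r → + e ℤ∣.∣ content f r ℤ.- + 1 ℤ.- ι → f′ (suc r) < f′ r
      removable i q with suc r ≟ ρ
      ... | no sr≢ρ = subst₂ _<_ (sym (f′r sr≢ρ)) (sym (f′r r≢ρ)) i
      ... | yes refl = subst₂ _<_ (sym f′ρ) (sym (f′r r≢ρ)) (≤∧≢⇒< i λ eq →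
        ∤-consecutive q e∣ (trans (consecutive (+ f (suc r)) (+ r) ι)
          (cong (λ n → (+ n ℤ.- + r ℤ.- + 1 ℤ.- ι) ℤ.- (+ f (suc r) ℤ.- + suc r ℤ.- ι)) eq)))
        where consecutive : ∀ x y z → + 1 ≡ ((+ 1 ℤ.+ x) ℤ.- y ℤ.- + 1 ℤ.- z) ℤ.- (x ℤ.- (+ 1 ℤ.+ y) ℤ.- z)
              consecutive = solve-∀

  -- Balancedness and admissible signs

  module _ {d : ℤ} {f : ℕ → ℕ} (mono : Mono f) where

    -- Each condition is the one for a single hook with its arm in row `k`, whose length is
    -- divisible by `e` because the congruences of the two signs can be subtracted.
    balanced⇒admissible : BalancedRows d (+ e) f → Admissible d (level f) (sign f)
    balanced⇒admissible bal {j} {k} k<j with sign f j in sj | sign f k in sk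
    ... | ⊕ | ⊕ = tt
    ... | ⊕ | ○ = tt
    ... | ⊖ | ⊖ = tt
    ... | ⊖ | ○ = tt
    ... | ○ | _ = tt
    ... | ⊖ | ⊕ with sign-⊖⁻ {f} {j} sj | sign-⊕⁻ {f} {k} sk
    ...   | i , q | _ , q′ with <⇒suc i
    -- The leg of the hook ends in the removable node of row `j`, which is in column `c`.
    ...     | c , fj , i′ =
      ∣-resp (bal k j c (≤-trans c<fj (mono-≤ mono (ℕ.<⇒≤ k<j))) c<fj i′
               (∣-difference q′ q (trans (hookLength (content f k) ι (+ c) (+ j))
                 (cong (λ n → (content f k ℤ.- ι) ℤ.- (+ n ℤ.- + j ℤ.- + 1 ℤ.- ι)) (sym fj)))))
             (trans (cong (λ n → (+ f k ℤ.- + 0) ℤ.- (+ n ℤ.- + 1) ℤ.- + 1) fj) (armLength (+ f k) (+ c)))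
      where
      hookLength : ∀ x y z w → x ℤ.- (z ℤ.- w) ≡ (x ℤ.- y) ℤ.- (((+ 1 ℤ.+ z) ℤ.- w) ℤ.- + 1 ℤ.- y)
      hookLength = solve-∀
      c<fj = ≤-reflexive (sym fj)
      armLength : ∀ x y → (x ℤ.- + 0) ℤ.- ((+ 1 ℤ.+ y) ℤ.- + 1) ℤ.- + 1 ≡ x ℤ.- (+ 1 ℤ.+ y)
      armLength = solve-∀
    -- The lower row is not the top row. The leg ends directly above its addable node, in row `j`
    -- and column `f (suc j)`.
    balanced⇒admissible bal {suc j} {k} k<j | ⊕ | ⊖ with sign-⊕⁻ {f} {suc j} sj | sign-⊖⁻ {f} {k} sk
    ...   | i , q | _ , q′ =
      ∣-resp (bal k j (f (suc j)) (<-≤-trans i (mono-≤ mono (s≤s⁻¹ k<j))) i ≤-refl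
               (∣-difference q′ q (hookLength (content f k) ι (+ f (suc j)) (+ j))))
             (armLength (+ f k) (+ f (suc j)))
      where
      hookLength : ∀ x y z w → x ℤ.- (z ℤ.- w) ≡ (x ℤ.- + 1 ℤ.- y) ℤ.- ((z ℤ.- (+ 1 ℤ.+ w)) ℤ.- y)
      hookLength = solve-∀
      armLength : ∀ x y → (x ℤ.- + 1) ℤ.- (y ℤ.- + 0) ≡ x ℤ.- (+ 1 ℤ.+ y)
      armLength = solve-∀

  module _ {d : ℤ} {f : ℕ → ℕ} (adm : Admissible d (level f) (sign f)) {j k : ℕ} (k<j : k < j) where

    rows-⊖⊕ : sign f j ≡ ⊖ → sign f k ≡ ⊕ → d ℤ∣.∣ + f k ℤ.- + f j
    rows-⊖⊕ sj sk = ∣-resp (admissible-⊖⊕ (level f) adm k<j sj sk)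
      (trans (eq (+ f k) (+ f j)) (sym (cong₂ (λ x y → x ℤ.- y ℤ.- + 1) (level-⊕ {f} sk) (level-⊖ {f} sj))))
      where eq : ∀ x y → x ℤ.- y ≡ x ℤ.- (y ℤ.- + 1) ℤ.- + 1
            eq = solve-∀

    rows-⊕⊖ : sign f j ≡ ⊕ → sign f k ≡ ⊖ → d ℤ∣.∣ (+ f k ℤ.- + 1) ℤ.- + f j
    rows-⊕⊖ sj sk = ∣-resp (admissible-⊕⊖ (level f) adm k<j sj sk)
      (sym (cong₂ ℤ._-_ (level-⊖ {f} sk) (level-⊕ {f} sj)))

  module _ {d : ℤ} {F : List ℕ} {f f′ : ℕ → ℕ} (mono : Mono f) (mono′ : Mono f′)
           (step : ∀ r → Step F f f′ r) where

    private
      raises : ∀ r → f r ≤ f′ r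
      raises r with step r
      ... | raised _ _ _ eq = ≤-trans (n≤1+n _) (≤-reflexive (sym eq))
      ... | kept _ _ eq     = ≤-reflexive (sym eq)

    -- The bead of a hook of `f′` is new if row `r` was raised, and its gap is new if `c < f t`
    -- fails, that is, if the node added in row `t` is in column `c`. If just one of them is new,
    -- admissibility applies when the other belongs to an `i`-node; when it does not, some hook of
    -- `f` has the same length and arm.
    balanced-raise : BalancedRows d (+ e) f → Admissible d (level f′) (sign f′) → BalancedRows d (+ e) f′
    balanced-raise bal adm r t c c<f′r c<f′t f′st≤c e∣hook = byRow (step r) (c <? f t)
      where
      fst≤c : f (suc t) ≤ c
      fst≤c = ≤-trans (raises (suc t)) f′st≤c

      raisedEnd : ¬ c < f t → sign f t ≡ ⊕ × sign f′ t ≡ ⊖ × f t ≡ c × f′ t ≡ suc c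
      raisedEnd c≮ft with step t
      ... | kept _ _ eq = contradiction (subst (c <_) eq c<f′t) c≮ft
      ... | raised _ st s′t eq = st , s′t , ft≡c , trans eq (cong suc ft≡c)
        where ft≡c = ≤-antisym (≮⇒≥ c≮ft) (s≤s⁻¹ (subst (c <_) eq c<f′t))

      aboveKept : ∀ r → c < f′ r → + e ℤ∣.∣ content f′ r ℤ.- (+ c ℤ.- + t) →
                  sign f′ r ≡ sign f r → f′ r ≡ f r → ¬ c < f t → Dec (Indented f r) → d ℤ∣.∣ + f′ r ℤ.- + suc c
      aboveKept r c<f′r e∣ sr eq c≮ft (yes i) with raisedEnd c≮ft
      ... | st , s′t , ft≡c , f′t≡ =
        subst (λ n → d ℤ∣.∣ + f′ r ℤ.- + n) f′t≡
          (rows-⊖⊕ adm (mono-< mono (subst₂ _<_ (sym ft≡c) eq c<f′r)) s′t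
            (trans sr (sign-⊕ {f} {r} (i , ∣-sum e∣ (proj₂ (sign-⊕⁻ {f} {t} st))
              (trans (congruent (+ f r) (+ r) (+ c) (+ t) ι)
                (cong₂ (λ m n → (+ m ℤ.- + r ℤ.- (+ c ℤ.- + t)) ℤ.+ (+ n ℤ.- + t ℤ.- ι)) (sym eq) (sym ft≡c)))))))
        where
        congruent : ∀ x y z w u → x ℤ.- y ℤ.- u ≡ (x ℤ.- y ℤ.- (z ℤ.- w)) ℤ.+ (z ℤ.- w ℤ.- u)
        congruent = solve-∀
      aboveKept zero c<f′r e∣ sr eq c≮ft (no ¬i) = contradiction tt ¬i
      -- Rows `r` and `suc r` have equal length in `f` and row `t` is indented, so moving the hook
      -- up by one row gives a hook of `f` with the same arm and leg.
      aboveKept (suc r) c<f′r e∣ sr eq c≮ft (no ¬i) with raisedEnd c≮ft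
      ... | st , s′t , ft≡c , f′t≡ = notIndented t refl
        where
        fr≡ : f r ≡ f′ (suc r)
        fr≡ = trans (≤-antisym (≮⇒≥ ¬i) (mono r)) (sym eq)
        shift : ∀ x y z w → x ℤ.- y ℤ.- (z ℤ.- w) ≡ x ℤ.- (+ 1 ℤ.+ y) ℤ.- (z ℤ.- (+ 1 ℤ.+ w))
        shift = solve-∀
        notIndented : ∀ u → u ≡ t → d ℤ∣.∣ + f′ (suc r) ℤ.- + suc c
        notIndented zero refl = contradiction (mono-< mono (subst₂ _<_ (sym ft≡c) eq c<f′r)) λ ()
        notIndented (suc u) refl = subst (λ n → d ℤ∣.∣ + n ℤ.- + suc c) fr≡
          (bal r u c (subst (c <_) (sym fr≡) c<f′r) (subst (_< f u) ft≡c (proj₁ (sign-⊕⁻ {f} {suc u} st)))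
            (≤-reflexive ft≡c)
            (∣-resp e∣ (trans (cong (λ n → + n ℤ.- + r ℤ.- (+ c ℤ.- + u)) fr≡) (shift (+ f′ (suc r)) (+ r) (+ c) (+ u)))))

      byRow : Step F f f′ r → Dec (c < f t) → d ℤ∣.∣ + f′ r ℤ.- + suc c
      byRow (kept _ _ eq) (yes c<ft) = subst (λ n → d ℤ∣.∣ + n ℤ.- + suc c) (sym eq)
        (bal r t c (subst (c <_) eq c<f′r) c<ft fst≤c
          (subst (λ n → + e ℤ∣.∣ + n ℤ.- + r ℤ.- (+ c ℤ.- + t)) eq e∣hook))
      byRow (kept _ sr eq) (no c≮ft) = aboveKept r c<f′r e∣hook sr eq c≮ft (indented? f r)
      -- Bead and gap have moved to different runners, so `e` cannot divide the hook length.
      byRow (raised _ sr _ eq) (no c≮ft) with raisedEnd c≮ft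
      ... | st , _ , ft≡c , _ = contradiction
        (trans (consecutive (+ f r) (+ r) (+ c) (+ t) ι)
          (cong₂ (λ m n → (+ m ℤ.- + r ℤ.- (+ c ℤ.- + t)) ℤ.- ((+ f r ℤ.- + r ℤ.- ι) ℤ.- (+ n ℤ.- + t ℤ.- ι)))
                 (sym eq) (sym ft≡c)))
        (∤-consecutive e∣hook (ℤ∣.∣m∣n⇒∣m-n (proj₂ (sign-⊕⁻ {f} {r} sr)) (proj₂ (sign-⊕⁻ {f} {t} st))))
        where
        consecutive : ∀ x y z w u → + 1 ≡ ((+ 1 ℤ.+ x) ℤ.- y ℤ.- (z ℤ.- w)) ℤ.- ((x ℤ.- y ℤ.- u) ℤ.- (z ℤ.- w ℤ.- u))
        consecutive = solve-∀
      byRow (raised _ sr s′r eq) (yes c<ft) with m≤n⇒m<n∨m≡n (s≤s⁻¹ (subst (c <_) eq c<f′r))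
      -- Column `c` would be that of the node added in row `r`. Row `t`, being longer than row `r`
      -- in `f`, is above it and so is not the lowest row of `f′` that reaches this column.
      ... | inj₂ refl = contradiction
        (<-≤-trans (subst (f r <_) (sym eq) ≤-refl) (≤-trans (mono-≤ mono′ (mono-< mono c<ft)) f′st≤c)) (<-irrefl refl)
      ... | inj₁ c<fr with m≤n⇒m<n∨m≡n fst≤c
      -- Row `suc t` ends just before column `c`, so it was a ⊕; it was not raised, as it still does
      -- not reach column `c`. Hence it is a ⊕ below the new ⊖ of row `r`.
      ...   | inj₂ fst≡c = ∣-resp (rows-⊕⊖ adm (mono-< mono (subst (_< f r) (sym fst≡c) c<fr)) s′st s′r)
                (trans (armLength (+ f′ r) (+ c)) (cong (λ n → + f′ r ℤ.- + 1 ℤ.- + n) (sym f′st≡c)))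
        where
        armLength : ∀ x y → x ℤ.- (+ 1 ℤ.+ y) ≡ x ℤ.- + 1 ℤ.- y
        armLength = solve-∀
        f′st≡c : f′ (suc t) ≡ c
        f′st≡c = ≤-antisym f′st≤c (≤-trans (≤-reflexive (sym fst≡c)) (raises (suc t)))
        congruent : ∀ x y z w u → z ℤ.- (+ 1 ℤ.+ w) ℤ.- u ≡ (x ℤ.- y ℤ.- u) ℤ.- ((+ 1 ℤ.+ x) ℤ.- y ℤ.- (z ℤ.- w))
        congruent = solve-∀
        st≡⊕ : sign f (suc t) ≡ ⊕
        st≡⊕ = sign-⊕ {f} {suc t} (subst (_< f t) (sym fst≡c) c<ft ,
          ∣-difference (proj₂ (sign-⊕⁻ {f} {r} sr)) e∣hook
            (trans (cong (λ n → + n ℤ.- + suc t ℤ.- ι) fst≡c)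
              (trans (congruent (+ f r) (+ r) (+ c) (+ t) ι)
                (cong (λ n → (+ f r ℤ.- + r ℤ.- ι) ℤ.- (+ n ℤ.- + r ℤ.- (+ c ℤ.- + t))) (sym eq)))))
        s′st : sign f′ (suc t) ≡ ⊕
        s′st with step (suc t)
        ... | kept _ s≡ _ = trans s≡ st≡⊕
        ... | raised _ _ _ f′st≡ = contradiction
          (trans (sym f′st≡c) (trans f′st≡ (cong suc fst≡c))) λ c≡ → <-irrefl c≡ ≤-refl
      -- The column to the left has the same lowest row `t` in `f`; moving there compensates for the
      -- shorter row `r`.
      ...   | inj₁ (s≤s {n = c₀} fst≤c₀) = ∣-resp
        (bal r t c₀ (≤-trans (n≤1+n _) c<fr) (≤-trans (n≤1+n _) c<ft) fst≤c₀
          (∣-resp e∣hook (trans (shift (+ f r) (+ r) (+ c₀) (+ t))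
            (cong (λ n → + n ℤ.- + r ℤ.- (+ c ℤ.- + t)) (sym eq)))))
        (trans (cong (λ n → + n ℤ.- + suc c) eq) (simplify (+ f r) (+ c)))
        where
        shift : ∀ x y z w → x ℤ.- y ℤ.- (z ℤ.- w) ≡ (+ 1 ℤ.+ x) ℤ.- y ℤ.- ((+ 1 ℤ.+ z) ℤ.- w)
        shift = solve-∀
        simplify : ∀ x y → (+ 1 ℤ.+ x) ℤ.- (+ 1 ℤ.+ y) ≡ x ℤ.- y
        simplify = solve-∀

    -- The same case distinction with `f` and `f′` exchanged. The gap has changed if row `suc t` of
    -- `f′` reaches column `c`, and the substitute hooks of `f′` are found one row down or one
    -- column to the right.
    balanced-lower : BalancedRows d (+ e) f′ → Admissible d (level f) (sign f) → BalancedRows d (+ e) f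
    balanced-lower bal adm r t c c<fr c<ft fst≤c e∣hook = byRow (step r) (f′ (suc t) ≤? c)
      where
      c<f′t : c < f′ t
      c<f′t = ≤-trans c<ft (raises t)

      raisedNext : ¬ f′ (suc t) ≤ c →
                   sign f (suc t) ≡ ⊕ × sign f′ (suc t) ≡ ⊖ × f (suc t) ≡ c × f′ (suc t) ≡ suc c
      raisedNext f′st≰c with step (suc t)
      ... | kept _ _ eq = contradiction (subst (_≤ c) (sym eq) fst≤c) f′st≰c
      ... | raised _ ss s′s eq = ss , s′s , fst≡c , trans eq (cong suc fst≡c)
        where fst≡c = ≤-antisym fst≤c (s≤s⁻¹ (subst (c <_) eq (≰⇒> f′st≰c)))

      byRow : Step F f f′ r → Dec (f′ (suc t) ≤ c) → d ℤ∣.∣ + f r ℤ.- + suc c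
      byRow (kept _ _ eq) (yes f′st≤c) = subst (λ n → d ℤ∣.∣ + n ℤ.- + suc c) eq
        (bal r t c (subst (c <_) (sym eq) c<fr) c<f′t f′st≤c
          (subst (λ n → + e ℤ∣.∣ + n ℤ.- + r ℤ.- (+ c ℤ.- + t)) (sym eq) e∣hook))
      byRow (kept _ sr eq) (no f′st≰c) with raisedNext f′st≰c | m≤n⇒m<n∨m≡n (mono′ r)
      ... | ss , s′s , fst≡c , f′st≡ | inj₁ fsr<fr =
        ∣-resp (rows-⊕⊖ adm (mono-< mono (subst (_< f r) (sym fst≡c) c<fr)) ss (trans (sym sr) (sign-⊖ {f′} {r} (fsr<fr ,
            ∣-sum e∣hook (proj₂ (sign-⊕⁻ {f} {suc t} ss))
              (trans (cong (λ n → + n ℤ.- + r ℤ.- + 1 ℤ.- ι) eq) (trans (congruent (+ f r) (+ r) (+ c) (+ t) ι)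
                (cong (λ n → (+ f r ℤ.- + r ℤ.- (+ c ℤ.- + t)) ℤ.+ (+ n ℤ.- + suc t ℤ.- ι)) (sym fst≡c))))))))
          (trans (armLength (+ f r) (+ c)) (cong (λ n → + f r ℤ.- + 1 ℤ.- + n) (sym fst≡c)))
        where
        armLength : ∀ x y → x ℤ.- (+ 1 ℤ.+ y) ≡ x ℤ.- + 1 ℤ.- y
        armLength = solve-∀
        congruent : ∀ x y z w u → x ℤ.- y ℤ.- + 1 ℤ.- u ≡ (x ℤ.- y ℤ.- (z ℤ.- w)) ℤ.+ (z ℤ.- (+ 1 ℤ.+ w) ℤ.- u)
        congruent = solve-∀
      -- Rows `r` and `suc r` of `f′` have equal length, so the hook can move down by one row; its
      -- lowest row becomes `suc t`, which ends in column `c` in `f′`.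
      ... | ss , s′s , fst≡c , f′st≡ | inj₂ fsr≡fr =
        subst (λ n → d ℤ∣.∣ + n ℤ.- + suc c) fsr≡
          (bal (suc r) (suc t) c (subst (c <_) (sym fsr≡) c<fr) (≤-reflexive (sym f′st≡))
            (s≤s⁻¹ (subst (f′ (suc (suc t)) <_) f′st≡ (proj₁ (sign-⊖⁻ {f′} {suc t} s′s))))
            (∣-resp e∣hook (trans (cong (λ n → + n ℤ.- + suc r ℤ.- (+ c ℤ.- + suc t)) fsr≡)
              (shift (+ f r) (+ r) (+ c) (+ t)))))
        where
        fsr≡ : f′ (suc r) ≡ f r
        fsr≡ = trans fsr≡fr eq
        shift : ∀ x y z w → x ℤ.- (+ 1 ℤ.+ y) ℤ.- (z ℤ.- (+ 1 ℤ.+ w)) ≡ x ℤ.- y ℤ.- (z ℤ.- w)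
        shift = solve-∀
      byRow (raised _ sr _ eq) (no f′st≰c) with raisedNext f′st≰c
      ... | ss , _ , fst≡c , _ = contradiction
        (trans (consecutive (+ f r) (+ r) (+ c) (+ t) ι)
          (cong (λ n → ((+ f r ℤ.- + r ℤ.- ι) ℤ.- (+ n ℤ.- + suc t ℤ.- ι)) ℤ.- (+ f r ℤ.- + r ℤ.- (+ c ℤ.- + t)))
                (sym fst≡c)))
        (∤-consecutive (ℤ∣.∣m∣n⇒∣m-n (proj₂ (sign-⊕⁻ {f} {r} sr)) (proj₂ (sign-⊕⁻ {f} {suc t} ss))) e∣hook)
        where
        consecutive : ∀ x y z w u →
          + 1 ≡ ((x ℤ.- y ℤ.- u) ℤ.- (z ℤ.- (+ 1 ℤ.+ w) ℤ.- u)) ℤ.- (x ℤ.- y ℤ.- (z ℤ.- w))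
        consecutive = solve-∀
      byRow (raised _ sr s′r eq) (yes f′st≤c) with m≤n⇒m<n∨m≡n c<f′t
      ... | inj₁ sc<f′t = ∣-resp
        (bal r t (suc c) (subst (suc c <_) (sym eq) (s≤s c<fr)) sc<f′t (m≤n⇒m≤1+n f′st≤c)
          (∣-resp e∣hook (trans (cong (λ n → + n ℤ.- + r ℤ.- (+ suc c ℤ.- + t)) eq) (shift (+ f r) (+ r) (+ c) (+ t)))))
        (trans (simplify (+ f r) (+ suc c)) (cong (λ n → + n ℤ.- + suc (suc c)) (sym eq)))
        where
        shift : ∀ x y z w → (+ 1 ℤ.+ x) ℤ.- y ℤ.- ((+ 1 ℤ.+ z) ℤ.- w) ≡ x ℤ.- y ℤ.- (z ℤ.- w)
        shift = solve-∀
        simplify : ∀ x y → x ℤ.- y ≡ (+ 1 ℤ.+ x) ℤ.- (+ 1 ℤ.+ y)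
        simplify = solve-∀
      -- Row `t` ends in column `c` in both `f` and `f′`, so it is a kept ⊖ below the ⊕ of row `r`.
      ... | inj₂ sc≡f′t = subst (λ n → d ℤ∣.∣ + f r ℤ.- + n) ft≡
        (rows-⊖⊕ adm (mono-< mono′ (subst₂ _<_ sc≡f′t (sym eq) (s≤s c<fr))) st sr)
        where
        ft≡ : f t ≡ suc c
        ft≡ = ≤-antisym (≤-trans (raises t) (≤-reflexive (sym sc≡f′t))) c<ft
        congruent : ∀ x y z w u → (+ 1 ℤ.+ z) ℤ.- w ℤ.- + 1 ℤ.- u ≡ (x ℤ.- y ℤ.- u) ℤ.- (x ℤ.- y ℤ.- (z ℤ.- w))
        congruent = solve-∀
        s′t : sign f′ t ≡ ⊖
        s′t = sign-⊖ {f′} {t} (≤-<-trans f′st≤c c<f′t ,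
          ∣-difference (proj₂ (sign-⊕⁻ {f} {r} sr)) e∣hook
            (trans (cong (λ n → + n ℤ.- + t ℤ.- + 1 ℤ.- ι) (sym sc≡f′t)) (congruent (+ f r) (+ r) (+ c) (+ t) ι)))
        st : sign f t ≡ ⊖
        st with step t
        ... | kept _ s≡ _ = trans (sym s≡) s′t
        ... | raised _ _ _ f′t≡ = contradiction (trans sc≡f′t (trans f′t≡ (cong suc ft≡))) λ c≡ → <-irrefl c≡ ≤-refl

-- Partitions as lists of row lengths

mono-raise : ∀ {f f′ ρ} → Mono f → Indented f ρ → f′ ρ ≡ suc (f ρ) → (∀ {r} → r ≢ ρ → f′ r ≡ f r) → Mono f′
mono-raise {f} {f′} {ρ} mono i f′ρ f′r r with r ≟ ρ | suc r ≟ ρ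
... | yes refl | yes sr≡r = contradiction sr≡r λ ()
... | yes refl | no sr≢ρ  = subst₂ _≤_ (sym (f′r sr≢ρ)) (sym f′ρ) (≤-trans (mono r) (n≤1+n _))
... | no r≢ρ   | yes refl = subst₂ _≤_ (sym f′ρ) (sym (f′r r≢ρ)) i
... | no r≢ρ   | no sr≢ρ  = subst₂ _≤_ (sym (f′r sr≢ρ)) (sym (f′r r≢ρ)) (mono r)

mono-lower : ∀ {f f′ ρ} → Mono f → f (suc ρ) < f ρ → f′ ρ ≡ pred (f ρ) → (∀ {r} → r ≢ ρ → f′ r ≡ f r) → Mono f′
mono-lower {f} {f′} {ρ} mono i f′ρ f′r r with r ≟ ρ | suc r ≟ ρ
... | yes refl | yes sr≡r = contradiction sr≡r λ ()
... | yes refl | no sr≢ρ  = subst₂ _≤_ (sym (f′r sr≢ρ)) (sym f′ρ) (<⇒≤pred i)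
... | no r≢ρ   | yes refl = subst₂ _≤_ (sym f′ρ) (sym (f′r r≢ρ)) (≤-trans pred[n]≤n (mono r))
... | no r≢ρ   | no sr≢ρ  = subst₂ _≤_ (sym (f′r sr≢ρ)) (sym (f′r r≢ρ)) (mono r)

linked⇒mono : ∀ {xs} → Linked _≥_ xs → Mono (rowLength xs)
linked⇒mono []       _       = z≤n
linked⇒mono [-]      _       = z≤n
linked⇒mono (x ∷ _)  zero    = x
linked⇒mono (_ ∷ xs) (suc r) = linked⇒mono xs r

mono⇒linked : ∀ xs → Mono (rowLength xs) → Linked _≥_ xs
mono⇒linked []           _    = []
mono⇒linked (_ ∷ [])     _    = [-]
mono⇒linked (_ ∷ y ∷ xs) mono = mono 0 ∷ mono⇒linked (y ∷ xs) (λ r → mono (suc r))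

rowLength-beyond : ∀ xs {r} → length xs ≤ r → rowLength xs r ≡ 0
rowLength-beyond []       _         = refl
rowLength-beyond (_ ∷ xs) (s≤s len) = rowLength-beyond xs len

rowLength-addBox : ∀ r xs → rowLength (addBox r xs) r ≡ suc (rowLength xs r)
rowLength-addBox zero    []       = refl
rowLength-addBox zero    (_ ∷ _)  = refl
rowLength-addBox (suc r) []       = rowLength-addBox r []
rowLength-addBox (suc r) (_ ∷ xs) = rowLength-addBox r xs

rowLength-addBox-≢ : ∀ ρ xs {r} → r ≢ ρ → rowLength (addBox ρ xs) r ≡ rowLength xs r
rowLength-addBox-≢ zero    xs       {zero}  r≢ρ = contradiction refl r≢ρ
rowLength-addBox-≢ zero    []       {suc r} r≢ρ = refl
rowLength-addBox-≢ zero    (x ∷ xs) {suc r} r≢ρ = refl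
rowLength-addBox-≢ (suc ρ) []       {zero}  r≢ρ = refl
rowLength-addBox-≢ (suc ρ) (x ∷ xs) {zero}  r≢ρ = refl
rowLength-addBox-≢ (suc ρ) []       {suc r} r≢ρ = rowLength-addBox-≢ ρ [] (λ eq → r≢ρ (cong suc eq))
rowLength-addBox-≢ (suc ρ) (x ∷ xs) {suc r} r≢ρ = rowLength-addBox-≢ ρ xs (λ eq → r≢ρ (cong suc eq))

rowLength-removeBox : ∀ r xs → rowLength (removeBox r xs) r ≡ pred (rowLength xs r)
rowLength-removeBox zero    []                 = refl
rowLength-removeBox (suc r) []                 = refl
rowLength-removeBox zero    (0 ∷ _)            = refl
rowLength-removeBox zero    (1 ∷ [])           = refl
rowLength-removeBox zero    (1 ∷ _ ∷ _)        = refl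
rowLength-removeBox zero    (suc (suc _) ∷ _)  = refl
rowLength-removeBox (suc r) (_ ∷ xs)           = rowLength-removeBox r xs

rowLength-removeBox-suc : ∀ r xs → rowLength xs r > 0 → rowLength xs r ≡ suc (rowLength (removeBox r xs) r)
rowLength-removeBox-suc r xs pos with rowLength xs r | rowLength-removeBox r xs
... | suc n | eq = cong suc (sym eq)

rowLength-removeBox-≢ : ∀ ρ xs {r} → r ≢ ρ → rowLength (removeBox ρ xs) r ≡ rowLength xs r
rowLength-removeBox-≢ zero    xs                {zero}  r≢ρ = contradiction refl r≢ρ
rowLength-removeBox-≢ zero    []                {suc r} r≢ρ = refl
rowLength-removeBox-≢ zero    (0 ∷ _)           {suc r} r≢ρ = refl
rowLength-removeBox-≢ zero    (1 ∷ [])          {suc r} r≢ρ = refl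
rowLength-removeBox-≢ zero    (1 ∷ _ ∷ _)       {suc r} r≢ρ = refl
rowLength-removeBox-≢ zero    (suc (suc _) ∷ _) {suc r} r≢ρ = refl
rowLength-removeBox-≢ (suc ρ) []                {r}     r≢ρ = refl
rowLength-removeBox-≢ (suc ρ) (_ ∷ xs)          {zero}  r≢ρ = refl
rowLength-removeBox-≢ (suc ρ) (_ ∷ xs)          {suc r} r≢ρ = rowLength-removeBox-≢ ρ xs (λ eq → r≢ρ (cong suc eq))

addBox-positive : ∀ r {xs} → All (_> 0) xs → Indented (rowLength xs) r → All (_> 0) (addBox r xs)
addBox-positive zero          []       _ = s≤s z≤n ∷ []
addBox-positive zero          (_ ∷ ps) _ = s≤s z≤n ∷ ps
addBox-positive (suc zero)    (p ∷ ps) _ = p ∷ addBox-positive zero ps tt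
addBox-positive (suc (suc r)) (p ∷ ps) i = p ∷ addBox-positive (suc r) ps i

removeBox-positive : ∀ r {xs} → All (_> 0) xs → rowLength xs (suc r) < rowLength xs r → All (_> 0) (removeBox r xs)
removeBox-positive zero    {1 ∷ []}          (_ ∷ [])     _        = []
removeBox-positive zero    {1 ∷ y ∷ _}       (_ ∷ q ∷ _)  (s≤s y≤0) = contradiction (<-≤-trans q y≤0) λ ()
removeBox-positive zero    {suc (suc _) ∷ _} (_ ∷ ps)     _        = s≤s z≤n ∷ ps
removeBox-positive (suc r) {_ ∷ _}           (p ∷ ps)     i        = p ∷ removeBox-positive r ps i

row-mono : ∀ p → Mono (row p)
row-mono p = linked⇒mono (proj₁ (isPartition p))

indented⇒addable : ∀ p r → Indented (row p) r → Addable p r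
indented⇒addable p r i =
  mono⇒linked _ (mono-raise (row-mono p) i (rowLength-addBox r (parts p)) (rowLength-addBox-≢ r (parts p))) ,
  addBox-positive r (proj₂ (isPartition p)) i

addable⇒indented : ∀ p r → Addable p r → Indented (row p) r
addable⇒indented p zero    _       = tt
addable⇒indented p (suc r) (l , _) =
  subst₂ _≤_ (rowLength-addBox (suc r) (parts p)) (rowLength-addBox-≢ (suc r) (parts p) λ ()) (linked⇒mono l r)

descent⇒removable : ∀ p r → row p (suc r) < row p r → Removable p r
descent⇒removable p r i = ≤-<-trans z≤n i ,
  mono⇒linked _ (mono-lower (row-mono p) i (rowLength-removeBox r (parts p)) (rowLength-removeBox-≢ r (parts p))) ,
  removeBox-positive r (proj₂ (isPartition p)) i

removable⇒descent : ∀ p r → Removable p r → row p (suc r) < row p r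
removable⇒descent p r (pos , l , _) with row p r | rowLength-removeBox r (parts p)
... | suc n | eq = s≤s (subst₂ _≤_ (rowLength-removeBox-≢ r (parts p) λ ()) eq (linked⇒mono l r))

-- Hooks, arms and columns as integers

+-∸ : ∀ {m n} → n ≤ m → + (m ∸ n) ≡ + m ℤ.- + n
+-∸ {m} {n} n≤m = sym (trans (ℤ.m-n≡m⊖n m n) (ℤ.⊖-≥ n≤m))

-- The rows weakly decrease, so those longer than `c` form an initial segment and their number is
-- the index of the first row not longer than `c`.
columnLength : ∀ c xs → Mono (rowLength xs) → let n = length (filter (c <?_) xs) in
               (∀ {t} → t < n → c < rowLength xs t) × rowLength xs n ≤ c
columnLength c []    mono = (λ ()) , z≤n
columnLength c (x ∷ xs) mono with c <? x
... | yes c<x rewrite filter-accept (c <?_) {xs = xs} c<x = below , proj₂ IH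
  where
  IH = columnLength c xs (λ r → mono (suc r))
  below : ∀ {t} → t < suc (length (filter (c <?_) xs)) → c < rowLength (x ∷ xs) t
  below {zero}  _         = c<x
  below {suc t} (s≤s t<n) = proj₁ IH t<n
... | no c≮x rewrite filter-reject (c <?_) {xs = xs} c≮x with filter (c <?_) xs | columnLength c xs (λ r → mono (suc r))
...   | []    | _         = (λ ()) , ≮⇒≥ c≮x
...   | _ ∷ _ | below , _ = contradiction (<-≤-trans (below (s≤s z≤n)) (mono 0)) c≮x

col-unique : ∀ p {t c} → c < row p t → row p (suc t) ≤ c → col p c ≡ suc t
col-unique p {t} {c} c<t st≤c with columnLength c (parts p) (row-mono p)
... | below , above = ≤-antisym
  (≮⇒≥ λ st<n → <-irrefl refl (<-≤-trans (below st<n) st≤c))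
  (≮⇒≥ λ n≤t → <-irrefl refl (<-≤-trans c<t (≤-trans (mono-≤ (row-mono p) (s≤s⁻¹ n≤t)) above)))

-- The truncated subtractions are exact: row `r` reaches column `c` and row `suc t` does not, whence
-- `r` is at most `t`.
hook-arm : ∀ p {r t c} → c < row p r → row p (suc t) ≤ c → col p c ≡ suc t →
           + hook p (r , c) ≡ content (row p) r ℤ.- (+ c ℤ.- + t) × + arm p (r , c) ≡ + row p r ℤ.- + suc c
hook-arm p {r} {t} {c} c<fr st≤c eq =
  trans (cong₂ (λ x y → x ℤ.+ y ℤ.+ + 1) (+-∸ c<fr) leg≡) (shift (+ row p r) (+ r) (+ c) (+ t)) , +-∸ c<fr
  where
  leg≡ : + leg p (r , c) ≡ + t ℤ.- + r
  leg≡ = trans (cong (λ n → + (n ∸ suc r)) eq) (+-∸ (s≤s⁻¹ (mono-< (row-mono p) (≤-<-trans st≤c c<fr))))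
  shift : ∀ x y z w → (x ℤ.- (+ 1 ℤ.+ z)) ℤ.+ (w ℤ.- y) ℤ.+ + 1 ≡ (x ℤ.- y) ℤ.- (z ℤ.- w)
  shift = solve-∀

balanced⇒rows : ∀ {d e} p → Balanced d e p → BalancedRows (+ d) (+ e) (row p)
balanced⇒rows p bal r t c c<fr c<ft st≤c e∣ with hook-arm p c<fr st≤c (col-unique p c<ft st≤c)
... | hook≡ , arm≡ = subst (_ ℤ∣.∣_) arm≡ (ℤ∣.∣ᵤ⇒∣ (bal (r , c) (r<length , c<fr)
        (ℤ∣.∣⇒∣ᵤ (subst (_ ℤ∣.∣_) (sym hook≡) e∣))))
  where
  r<length : r < length (parts p)
  r<length = ≰⇒> λ len≤r → contradiction (subst (c <_) (rowLength-beyond (parts p) len≤r) c<fr) λ ()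

col-nonempty : ∀ p {r c} → c < row p r → ∃ λ t → col p c ≡ suc t × c < row p t × row p (suc t) ≤ c
col-nonempty p {c = c} c<fr with col p c | columnLength c (parts p) (row-mono p)
... | zero  | _ , above     = contradiction (≤-trans (mono-≤ (row-mono p) z≤n) above) (<⇒≱ c<fr)
... | suc t | below , above = t , refl , below ≤-refl , above

rows⇒balanced : ∀ {d e} p → BalancedRows (+ d) (+ e) (row p) → Balanced d e p
rows⇒balanced p bal (r , c) (_ , c<fr) e∣ with col-nonempty p c<fr
... | t , eq , c<ft , st≤c with hook-arm p c<fr st≤c eq
...   | hook≡ , arm≡ = ℤ∣.∣⇒∣ᵤ (subst (_ ℤ∣.∣_) (sym arm≡)
        (bal r t c c<fr c<ft st≤c (subst (_ ℤ∣.∣_) hook≡ (ℤ∣.∣ᵤ⇒∣ e∣))))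

-- Residues as congruences

module _ {e : ℕ} .{{_ : NonZero e}} where

  ∣∸⇒≡ : ∀ {m n} → m < e → n ≤ m → + e ℤ∣.∣ + m ℤ.- + n → m ≡ n
  ∣∸⇒≡ {m} {n} m<e n≤m e∣ with m ∸ n in eq | ℤ∣.∣⇒∣ᵤ (subst (+ e ℤ∣.∣_) (sym (+-∸ n≤m)) e∣)
  ... | zero  | _ = ≤-antisym (m∸n≡0⇒m≤n eq) n≤m
  ... | suc k | e∣k = contradiction e∣k (>⇒∤ (≤-<-trans (subst (_≤ m) eq (m∸n≤m m n)) m<e))

  ∣-⇒≡ : ∀ {m n} → m < e → n < e → + e ℤ∣.∣ + m ℤ.- + n → m ≡ n
  ∣-⇒≡ {m} {n} m<e n<e e∣ with ≤-total m n
  ... | inj₂ n≤m = ∣∸⇒≡ m<e n≤m e∣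
  ... | inj₁ m≤n = sym (∣∸⇒≡ n<e m≤n (∣-resp (ℤ∣.∣m⇒∣-m e∣) (negate (+ m) (+ n))))
    where negate : ∀ x y → y ℤ.- x ≡ ℤ.- (x ℤ.- y)
          negate = solve-∀

  ∣-mod : ∀ x → + e ℤ∣.∣ x ℤ.- + (x %ℕ e)
  ∣-mod x = ℤ∣.divides (x /ℕ e)
    (trans (cong (ℤ._- + (x %ℕ e)) (a≡a%ℕn+[a/ℕn]*n x e)) (simplify (+ (x %ℕ e)) (x /ℕ e ℤ.* + e)))
    where simplify : ∀ x y → x ℤ.+ y ℤ.- x ≡ y
          simplify = solve-∀

  mod⇒∣ : ∀ x {n} → x %ℕ e ≡ n → + e ℤ∣.∣ x ℤ.- + n
  mod⇒∣ x eq = subst (λ n → + e ℤ∣.∣ x ℤ.- + n) eq (∣-mod x)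

  ∣⇒mod : ∀ x {n} → n < e → + e ℤ∣.∣ x ℤ.- + n → x %ℕ e ≡ n
  ∣⇒mod x {n} n<e e∣ = ∣-⇒≡ (n%ℕd<d x e) n<e (∣-difference e∣ (∣-mod x) (simplify (+ (x %ℕ e)) x (+ n)))
    where simplify : ∀ r x n → r ℤ.- n ≡ (x ℤ.- n) ℤ.- (x ℤ.- r)
          simplify = solve-∀

-- Signatures and iterated crystal operators

-- Only the rows of the signs are recorded; the proofs of addability and removability inside them
-- are arbitrary.
data Shape {p : Partition} : List (Sign p) → List ℕ → List ℕ → Set where
  []    : Shape [] [] []
  plus  : ∀ {r a R as bs} → Shape R as bs → Shape (plus (r , a) ∷ R) (r ∷ as) bs
  minus : ∀ {r a R bs} → Shape R [] bs → Shape (minus (r , a) ∷ R) [] (r ∷ bs)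

cancel-minus : ∀ {p r a} {R : List (Sign p)} {bs} → Shape R [] bs → cancel (minus (r , a)) R ≡ minus (r , a) ∷ R
cancel-minus []        = refl
cancel-minus (minus _) = refl

pluses-rows : ∀ {p} {R : List (Sign p)} {as bs} → Shape R as bs → map proj₁ (pluses R) ≡ as
pluses-rows []        = refl
pluses-rows (plus S)  = cong (_ ∷_) (pluses-rows S)
pluses-rows (minus S) = pluses-rows S

minuses-rows : ∀ {p} {R : List (Sign p)} {as bs} → Shape R as bs → map proj₁ (minuses R) ≡ bs
minuses-rows []        = refl
minuses-rows (plus S)  = minuses-rows S
minuses-rows (minus S) = cong (_ ∷_) (minuses-rows S)

module _ {A : ℕ → Set} where

  head-map : ∀ (xs : List (∃ A)) {ρ bs} → map proj₁ xs ≡ ρ ∷ bs → ∃ λ a → head xs ≡ just (ρ , a)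
  head-map ((_ , a) ∷ _) refl = a , refl

  last-map : ∀ (xs : List (∃ A)) as {ρ} → map proj₁ xs ≡ as ∷ʳ ρ → ∃ λ a → last xs ≡ just (ρ , a)
  last-map ((_ , a) ∷ []) []       refl = a , refl
  last-map (_ ∷ _ ∷ _)    []       ()
  last-map (_ ∷ [])       (_ ∷ []) ()
  last-map (_ ∷ [])       (_ ∷ _ ∷ _) ()
  last-map (_ ∷ x ∷ xs)   (_ ∷ as) eq   = last-map (x ∷ xs) as (∷-injectiveʳ eq)

-- The signature as a word of marks

module _ (e : ℕ) .{{_ : NonZero e}} (1<e : 1 < e) (i : Fin e) where

  open Signs e 1<e (+ toℕ i)

  pred-content : ∀ p {r} → row p r > 0 → + pred (row p r) ℤ.- + r ≡ content (row p) r ℤ.- + 1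
  pred-content p {r} pos with row p r
  ... | suc n = swap (+ n) (+ r)
    where swap : ∀ x y → x ℤ.- y ≡ (+ 1 ℤ.+ x) ℤ.- y ℤ.- + 1
          swap = solve-∀

  addableSign-plus : ∀ p r → Plus (row p) r → ∃ λ a → addableSign e i p r ≡ plus (r , a) ∷ []
  addableSign-plus p r (ind , e∣) with addable? p r ×-dec (residue e (addNode p r) ≟ toℕ i)
  ... | yes (a , _) = a , refl
  ... | no ¬a = contradiction (indented⇒addable p r ind , ∣⇒mod (content (row p) r) (toℕ<n i) e∣) ¬a

  addableSign-none : ∀ p r → ¬ Plus (row p) r → addableSign e i p r ≡ []
  addableSign-none p r ¬plus with addable? p r ×-dec (residue e (addNode p r) ≟ toℕ i)
  ... | yes (a , eq) = contradiction (addable⇒indented p r a , mod⇒∣ (content (row p) r) eq) ¬plus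
  ... | no _ = refl

  removableSign-minus : ∀ p r → Minus (row p) r → ∃ λ a → removableSign e i p r ≡ minus (r , a) ∷ []
  removableSign-minus p r (desc , e∣) with removable? p r ×-dec (residue e (removeNode p r) ≟ toℕ i)
  ... | yes (a , _) = a , refl
  ... | no ¬a = contradiction (descent⇒removable p r desc ,
                  ∣⇒mod (+ pred (row p r) ℤ.- + r) (toℕ<n i)
                    (subst (λ x → + e ℤ∣.∣ x ℤ.- + toℕ i) (sym (pred-content p (≤-<-trans z≤n desc))) e∣)) ¬a

  removableSign-none : ∀ p r → ¬ Minus (row p) r → removableSign e i p r ≡ []
  removableSign-none p r ¬minus with removable? p r ×-dec (residue e (removeNode p r) ≟ toℕ i)
  ... | yes (a , eq) = contradiction (removable⇒descent p r a ,
          subst (λ x → + e ℤ∣.∣ x ℤ.- + toℕ i) (pred-content p (proj₁ a)) (mod⇒∣ (+ pred (row p r) ℤ.- + r) eq)) ¬minus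
  ... | no _ = refl

  rowSigns : ∀ p → ℕ → List (Sign p)
  rowSigns p r = removableSign e i p r ++ addableSign e i p r

  rowSigns-⊕ : ∀ p {r} → sign (row p) r ≡ ⊕ → ∃ λ a → rowSigns p r ≡ plus (r , a) ∷ []
  rowSigns-⊕ p {r} s with addableSign-plus p r (sign-⊕⁻ {row p} {r} s)
  ... | a , eq = a , cong₂ _++_ (removableSign-none p r λ m → plus-minus-disjoint {row p} {r} (sign-⊕⁻ {row p} {r} s) m) eq

  rowSigns-⊖ : ∀ p {r} → sign (row p) r ≡ ⊖ → ∃ λ a → rowSigns p r ≡ minus (r , a) ∷ []
  rowSigns-⊖ p {r} s with removableSign-minus p r (sign-⊖⁻ {row p} {r} s)
  ... | a , eq = a , cong₂ _++_ eq (addableSign-none p r λ pl → plus-minus-disjoint {row p} {r} pl (sign-⊖⁻ {row p} {r} s))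

  rowSigns-○ : ∀ p {r} → sign (row p) r ≡ ○ → rowSigns p r ≡ []
  rowSigns-○ p {r} s = cong₂ _++_
    (removableSign-none p r λ m → contradiction (trans (sym (sign-⊖ {row p} {r} m)) s) λ ())
    (addableSign-none p r λ pl → contradiction (trans (sym (sign-⊕ {row p} {r} pl)) s) λ ())

  word : ∀ p → List ℕ → List (Sign p)
  word p = concatMap (rowSigns p)

  module _ (p : Partition) where

    reduce-row : ∀ {r S} → rowSigns p r ≡ S →
                 ∀ R L → foldr cancel R (word p (r ∷ L)) ≡ foldr cancel (foldr cancel R (word p L)) S
    reduce-row {r} refl R L = foldr-++ cancel R (rowSigns p r) (word p L)

    -- `reduce` works from the right, so a matched word has to vanish over an arbitrary `R`. Inside
    -- a pair, `R` starts with the closing plus, which the opening minus then cancels.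
    reduce-matched : ∀ {W} → Matching (sign (row p)) W [] [] → ∀ R → foldr cancel R (word p W) ≡ R
    reduce-pair : ∀ {r W a} → sign (row p) r ≡ ⊖ → Matching (sign (row p)) W [] [] → sign (row p) a ≡ ⊕ →
                  ∀ L R → foldr cancel R (word p (r ∷ W ++ a ∷ L)) ≡ foldr cancel R (word p L)
    reduce-matched []               R = refl
    reduce-matched (skip {L = L} sr D)      R = trans (reduce-row (rowSigns-○ p sr) R L) (reduce-matched D R)
    reduce-matched (pair {L = L} sr DW sa D) R = trans (reduce-pair sr DW sa L R) (reduce-matched D R)
    reduce-pair {r} {W} {a} sr DW sa L R = trans (reduce-row (proj₂ (rowSigns-⊖ p sr)) R (W ++ a ∷ L))
      (cong (cancel (minus (r , proj₁ (rowSigns-⊖ p sr))))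
        (trans (cong (foldr cancel R) (concatMap-++ (rowSigns p) W (a ∷ L)))
          (trans (foldr-++ cancel R (word p W) (word p (a ∷ L)))
            (trans (reduce-matched DW _) (reduce-row (proj₂ (rowSigns-⊕ p sa)) R L)))))

    shape : ∀ {L as bs} → Matching (sign (row p)) L as bs → Shape (reduce (word p L)) as bs
    shape [] = []
    shape (skip {L = L} sr D) = subst (λ R → Shape R _ _) (sym (reduce-row (rowSigns-○ p sr) [] L)) (shape D)
    shape (pair {L = L} sr DW sa D) = subst (λ R → Shape R _ _) (sym (reduce-pair sr DW sa L [])) (shape D)
    shape (closing {L = L} sr D) = subst (λ R → Shape R _ _)
      (sym (reduce-row (proj₂ (rowSigns-⊕ p sr)) [] L)) (plus (shape D))
    shape (opening {L = L} sr D) = subst (λ R → Shape R _ _)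
      (sym (trans (reduce-row (proj₂ (rowSigns-⊖ p sr)) [] L) (cancel-minus (shape D)))) (minus (shape D))

  -- A bound that stays valid during the iteration, so that one list `downFrom N` serves for all
  -- partitions met, whatever their numbers of parts.
  MarkedBelow : ℕ → Partition → Set
  MarkedBelow N p = ∀ {r} → N ≤ r → sign (row p) r ≡ ○

  -- The empty row just below the diagram may have an addable node, whence the `suc`; every later
  -- row follows an empty row and has none.
  markedBelow-length : ∀ p → MarkedBelow (suc (length (parts p))) p
  markedBelow-length p {suc r} (s≤s len≤r) = sign-○ {row p} {suc r}
    (λ (ind , _) → contradiction (subst (row p (suc r) <_) (rowLength-beyond (parts p) len≤r) ind) λ ())
    (λ (desc , _) → contradiction
      (subst (row p (suc (suc r)) <_) (rowLength-beyond (parts p) (≤-trans len≤r (n≤1+n _))) desc) λ ())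

  word-downFrom : ∀ p {N} → MarkedBelow N p → ∀ k → word p (downFrom (k + N)) ≡ word p (downFrom N)
  word-downFrom p bound zero    = refl
  word-downFrom p {N} bound (suc k) = cong₂ _++_ (rowSigns-○ p (bound (m+n≤o⇒n≤o k ≤-refl))) (word-downFrom p bound k)

  -- Extending both ranges of rows to a common longer one adds only unmarked rows.
  signature-downFrom : ∀ p {N} → MarkedBelow N p → signature e i p ≡ word p (downFrom N)
  signature-downFrom p {N} bound = trans (sym (word-downFrom p (markedBelow-length p) N))
    (trans (cong (λ n → word p (downFrom n)) (+-comm N _)) (word-downFrom p bound _))

  downFrom-descending : ∀ N → AllPairs _>_ (downFrom N)
  downFrom-descending N = applyDownFrom⁺₁ (λ r → r) N (λ j<i _ → j<i)

  module _ {N : ℕ} where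

    reducedShape : ∀ p {as bs} → MarkedBelow N p → Matching (sign (row p)) (downFrom N) as bs →
                   Shape (reducedSignature e i p) as bs
    reducedShape p bound D = subst (λ S → Shape (reduce S) _ _) (sym (signature-downFrom p bound)) (shape p D)

    f̃-last : ∀ p as {ρ bs} → MarkedBelow N p → Matching (sign (row p)) (downFrom N) (as ∷ʳ ρ) bs →
             ∃ λ a → f̃ e i p ≡ just (add p (ρ , a))
    f̃-last p as bound D with last-map _ as (pluses-rows (reducedShape p bound D))
    ... | a , eq = a , cong (Maybe.map (add p)) eq

    ẽ-head : ∀ p {as ρ bs} → MarkedBelow N p → Matching (sign (row p)) (downFrom N) as (ρ ∷ bs) →
             ∃ λ a → ẽ e i p ≡ just (remove p (ρ , a))
    ẽ-head p bound D with head-map _ (minuses-rows (reducedShape p bound D))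
    ... | a , eq = a , cong (Maybe.map (remove p)) eq

  single-raise : ∀ {f f′ ρ} → Mono f → Mono f′ → f′ ρ ≡ suc (f ρ) → (∀ {r} → r ≢ ρ → f′ r ≡ f r) →
                 + e ℤ∣.∣ content f ρ ℤ.- + toℕ i → ∀ r → Step [ ρ ] f f′ r
  single-raise {f} {f′} {ρ} mono mono′ f′ρ f′r e∣ r with r ≟ ρ
  ... | yes refl = raised (here refl) (raise-⊕ mono mono′ f′ρ f′r e∣) (raise-⊖ mono mono′ f′ρ f′r e∣) f′ρ
  ... | no r≢ρ   = kept (λ { (here r≡ρ) → r≢ρ r≡ρ }) (raise-kept mono mono′ f′ρ f′r e∣ r≢ρ) (f′r r≢ρ)

  -- No row is raised twice, since its sign is ⊖ after the first time. The order `G ++ F` fits both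
  -- iterations: `f̃` works through its rows from the end of the list, `ẽ` from the front.
  step-trans : ∀ {F G f g h r} → Step F f g r → Step G g h r → Step (G ++ F) f h r
  step-trans {F} {G} (raised r∈F fr gr _) (raised _ gr′ _ _) with () ← trans (sym gr) gr′
  step-trans {F} {G} (raised r∈F fr gr eq) (kept _ hr eq′) = raised (∈-++⁺ʳ G r∈F) fr (trans hr gr) (trans eq′ eq)
  step-trans {F} {G} (kept _ gr eq) (raised r∈G gr′ hr eq′) =
    raised (∈-++⁺ˡ r∈G) (trans (sym gr) gr′) hr (trans eq′ (cong suc eq))
  step-trans {F} {G} (kept r∉F gr eq) (kept r∉G hr eq′) = kept r∉ (trans hr gr) (trans eq′ eq)
    where
    r∉ : _ ∉ G ++ F
    r∉ r∈ with ∈-++⁻ G r∈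
    ... | inj₁ r∈G = r∉G r∈G
    ... | inj₂ r∈F = r∉F r∈F

  step-○ : ∀ {F f g r} → Step F f g r → sign f r ≡ ○ → sign g r ≡ ○
  step-○ (raised _ fr _ _) fr′ with () ← trans (sym fr) fr′
  step-○ (kept _ gr _)     fr′ = trans gr fr′

  step-○⁻ : ∀ {F f g r} → Step F f g r → sign g r ≡ ○ → sign f r ≡ ○
  step-○⁻ (raised _ _ gr _) gr′ with () ← trans (sym gr) gr′
  step-○⁻ (kept _ gr _)     gr′ = trans (sym gr) gr′

  add-step : ∀ p {ρ} (a : Addable p ρ) → sign (row p) ρ ≡ ⊕ → ∀ r → Step [ ρ ] (row p) (row (add p (ρ , a))) r
  add-step p {ρ} a s = single-raise (row-mono p) (row-mono (add p (ρ , a)))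
    (rowLength-addBox ρ (parts p)) (rowLength-addBox-≢ ρ (parts p)) (proj₂ (sign-⊕⁻ {row p} {ρ} s))

  remove-step : ∀ p {ρ} (a : Removable p ρ) → sign (row p) ρ ≡ ⊖ → ∀ r → Step [ ρ ] (row (remove p (ρ , a))) (row p) r
  remove-step p {ρ} a s = single-raise (row-mono q) (row-mono p)
    (rowLength-removeBox-suc ρ (parts p) (proj₁ a)) (λ r≢ρ → sym (rowLength-removeBox-≢ ρ (parts p) r≢ρ))
    (subst (λ x → + e ℤ∣.∣ x ℤ.- + toℕ i)
      (trans (sym (pred-content p (proj₁ a))) (cong (λ n → + n ℤ.- + ρ) (sym (rowLength-removeBox ρ (parts p)))))
      (proj₂ (sign-⊖⁻ {row p} {ρ} s)))
    where q = remove p (ρ , a)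

  step-marks : ∀ {ρ f g} → (∀ r → Step [ ρ ] f g r) →
               sign f ρ ≡ ⊕ × sign g ρ ≡ ⊖ × (∀ {r} → r ≢ ρ → sign g r ≡ sign f r)
  step-marks {ρ} steps with steps ρ
  ... | kept ρ∉ _ _ = contradiction (here refl) ρ∉
  ... | raised _ fρ gρ _ = fρ , gρ , others
    where
    others : ∀ {r} → r ≢ ρ → _
    others {r} r≢ρ with steps r
    ... | raised (here r≡ρ) _ _ _ = contradiction r≡ρ r≢ρ
    ... | kept _ gr _ = gr

  module _ {N : ℕ} where

    private
      L> = downFrom-descending N

    -- One application flips the last unmatched ⊕ and keeps all pairs, so the next one meets the
    -- same matching with `F` shortened by its last row.
    iterate-f̃ : ∀ n p as {F bs} → length F ≡ n → MarkedBelow N p →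
                Matching (sign (row p)) (downFrom N) (as ++ F) bs →
                ∃ λ q → iterate (f̃ e i) n p ≡ just q × ∀ r → Step F (row p) (row q) r
    iterate-f̃ zero    p as {[]} _ bound D = p , refl , λ r → kept (λ ()) refl refl
    iterate-f̃ (suc n) p as {F} len bound D with initLast F
    ... | F′ ∷ʳ′ ρ with f̃-last p (as ++ F′) bound D′
      where D′ = subst (λ xs → Matching (sign (row p)) (downFrom N) xs _) (sym (++-assoc as F′ [ ρ ])) D
    ...   | a , f̃p≡ = continue (iterate-f̃ n p′ as len′ bound′
                        (matching-⊕→⊖ (λ {r} → proj₂ (proj₂ marks) {r}) (proj₁ (proj₂ marks)) (as ++ F′) D′ L>))
      where
      D′ = subst (λ xs → Matching (sign (row p)) (downFrom N) xs _) (sym (++-assoc as F′ [ ρ ])) D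
      p′ = add p (ρ , a)
      len′ : length F′ ≡ n
      len′ = cong pred (trans (+-comm 1 _) (trans (sym (length-++ F′)) len))
      steps : ∀ r → Step [ ρ ] (row p) (row p′) r
      steps = add-step p a (unmatched-⊕ D (∈-++⁺ʳ as (∈-++⁺ʳ F′ (here refl))))
      marks = step-marks steps
      bound′ : MarkedBelow N p′
      bound′ N≤r = step-○ (steps _) (bound N≤r)
      continue : (∃ λ q → iterate (f̃ e i) n p′ ≡ just q × ∀ r → Step F′ (row p′) (row q) r) →
                 ∃ λ q → iterate (f̃ e i) (suc n) p ≡ just q × ∀ r → Step (F′ ∷ʳ ρ) (row p) (row q) r
      continue (q , eq , steps′) = q , trans (cong (_>>= iterate (f̃ e i) n) f̃p≡) eq ,
        λ r → step-trans (steps r) (steps′ r)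

    -- Here each application flips the first unmatched ⊖, which shortens `F` from the front.
    iterate-ẽ : ∀ n p {as} F {bs} → length F ≡ n → MarkedBelow N p →
                Matching (sign (row p)) (downFrom N) as (F ++ bs) →
                ∃ λ q → iterate (ẽ e i) n p ≡ just q × ∀ r → Step F (row q) (row p) r
    iterate-ẽ zero    p [] _ bound D = p , refl , λ r → kept (λ ()) refl refl
    iterate-ẽ (suc n) p {as} (ρ ∷ F) len bound D with ẽ-head p bound D
    ... | a , ẽp≡ = continue (iterate-ẽ n p′ F (cong pred len) bound′
                      (matching-⊖→⊕ (λ {r} r≢ρ → sym (proj₂ (proj₂ marks) {r} r≢ρ)) (proj₁ marks) D L>))
      where
      p′ = remove p (ρ , a)
      steps : ∀ r → Step [ ρ ] (row p′) (row p) r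
      steps = remove-step p a (unmatched-⊖ D (here refl))
      marks = step-marks steps
      bound′ : MarkedBelow N p′
      bound′ N≤r = step-○⁻ (steps _) (bound N≤r)
      continue : (∃ λ q → iterate (ẽ e i) n p′ ≡ just q × ∀ r → Step F (row q) (row p′) r) →
                 ∃ λ q → iterate (ẽ e i) (suc n) p ≡ just q × ∀ r → Step (ρ ∷ F) (row q) (row p) r
      continue (q , eq , steps′) = q , trans (cong (_>>= iterate (ẽ e i) n) ẽp≡) eq ,
        λ r → step-trans (steps′ r) (steps r)

  -- The reflection preserves balancedness

  module _ {d : ℕ} (p : Partition) (bal : Balanced d e p) where

    private
      N = suc (length (parts p))
      bound : MarkedBelow N p
      bound = markedBelow-length p
      L> = downFrom-descending N
      rows : BalancedRows (+ d) (+ e) (row p)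
      rows = balanced⇒rows p bal
      adm : Admissible (+ d) (level (row p)) (sign (row p))
      adm = balanced⇒admissible (row-mono p) rows
      marked : ∀ {r} → sign (row p) r ≢ ○ → r ∈ downFrom N
      marked {r} s≢○ with r <? N
      ... | yes r<N = ∈-downFrom⁺ r<N
      ... | no r≮N  = contradiction (bound (≮⇒≥ r≮N)) s≢○

      admissible-level : ∀ g {g′} s → (∀ r → g′ r ≡ g r) → Admissible (+ d) g s → Admissible (+ d) g′ s
      admissible-level g s eq adm {j} {k} k<j =
        subst₂ (λ x y → Compatible (+ d) (s j) (s k) (x ℤ.- y)) (sym (eq k)) (sym (eq j)) (adm k<j)

    raise-balanced : ∀ as₁ {F bs} → Matching (sign (row p)) (downFrom N) (as₁ ++ F) bs → length as₁ ≡ length bs →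
                     ∃[ q ] (iterate (f̃ e i) (length F) p ≡ just q × Balanced d e q)
    raise-balanced as₁ {F} D len with iterate-f̃ (length F) p as₁ refl bound D
    ... | q , eq , steps = q , eq , rows⇒balanced q (balanced-raise (row-mono p) (row-mono q) steps rows
      -- Levels are invariant, so only the change of signs has to be examined.
      (admissible-level (level (row p)) (sign (row q)) (λ r → level-step (steps r))
        (admissible-⊕→⊖ {g = level (row p)} L> marked adm as₁ D len flips)))
      where
      flips : ∀ r → (r ∈ F × sign (row q) r ≡ ⊖) ⊎ (r ∉ F × sign (row q) r ≡ sign (row p) r)
      flips r with steps r
      ... | raised r∈ _ s _ = inj₁ (r∈ , s)
      ... | kept r∉ s _     = inj₂ (r∉ , s)

    lower-balanced : ∀ {as} F {bs} → Matching (sign (row p)) (downFrom N) as (F ++ bs) → length bs ≡ length as →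
                     ∃[ q ] (iterate (ẽ e i) (length F) p ≡ just q × Balanced d e q)
    lower-balanced F D len with iterate-ẽ (length F) p F refl bound D
    ... | q , eq , steps = q , eq , rows⇒balanced q (balanced-lower (row-mono q) (row-mono p) steps rows
      (admissible-level (level (row p)) (sign (row q)) (λ r → sym (level-step (steps r)))
        (admissible-⊖→⊕ {g = level (row p)} L> marked adm F D len flips)))
      where
      flips : ∀ r → (r ∈ F × sign (row q) r ≡ ⊕) ⊎ (r ∉ F × sign (row q) r ≡ sign (row p) r)
      flips r with steps r
      ... | raised r∈ s _ _ = inj₁ (r∈ , s)
      ... | kept r∉ s _     = inj₂ (r∉ , sym s)

    σ-balanced : ∃[ q ] (σ e i p ≡ just q × Balanced d e q)
    σ-balanced with matching {sign (row p)} (downFrom N)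
    ... | as , bs , D = go
      where
      S = reducedShape p bound D
      φ≡ : φ e i p ≡ length as
      φ≡ = trans (sym (length-map proj₁ (pluses (reducedSignature e i p)))) (cong length (pluses-rows S))
      ε≡ : ε e i p ≡ length bs
      ε≡ = trans (sym (length-map proj₁ (minuses (reducedSignature e i p)))) (cong length (minuses-rows S))

      up : ε e i p ≤ φ e i p → ∃[ q ] (iterate (f̃ e i) (φ e i p ∸ ε e i p) p ≡ just q × Balanced d e q)
      up ε≤φ = subst (λ n → ∃[ q ] (iterate (f̃ e i) n p ≡ just q × Balanced d e q)) len
        -- The lowest ⊕, as many as there are unmatched ⊖, are kept; the number of the others is the
        -- number of applications of `f̃`.
        (raise-balanced (take (length bs) as)
          (subst (λ xs → Matching (sign (row p)) (downFrom N) xs bs) (sym (take++drop≡id (length bs) as)) D)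
          (trans (length-take (length bs) as) (m≤n⇒m⊓n≡m (subst₂ _≤_ ε≡ φ≡ ε≤φ))))
        where
        len : length (drop (length bs) as) ≡ φ e i p ∸ ε e i p
        len = trans (length-drop (length bs) as) (sym (cong₂ _∸_ φ≡ ε≡))

      down : φ e i p ≤ ε e i p → ∃[ q ] (iterate (ẽ e i) (ε e i p ∸ φ e i p) p ≡ just q × Balanced d e q)
      down φ≤ε = subst (λ n → ∃[ q ] (iterate (ẽ e i) n p ≡ just q × Balanced d e q)) len-take
        (lower-balanced (take k bs)
          (subst (Matching (sign (row p)) (downFrom N) as) (sym (take++drop≡id k bs)) D)
          (trans (length-drop k bs) (m∸[m∸n]≡n (subst₂ _≤_ φ≡ ε≡ φ≤ε))))
        where
        -- The first `k` unmatched ⊖ are flipped, which leaves as many ⊖ as there were unmatched ⊕.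
        k = length bs ∸ length as
        len-take : length (take k bs) ≡ ε e i p ∸ φ e i p
        len-take = trans (length-take k bs) (trans (m≤n⇒m⊓n≡m (m∸n≤m (length bs) (length as))) (sym (cong₂ _∸_ ε≡ φ≡)))

      go : ∃[ q ] (σ e i p ≡ just q × Balanced d e q)
      go with <-cmp (ε e i p) (φ e i p)
      ... | tri< ε<φ _ _ = up (<⇒≤ ε<φ)
      ... | tri≈ _ _ _   = p , refl , bal
      ... | tri> _ _ φ<ε = down (<⇒≤ φ<ε)

theorem4p4 : (d e : ℕ) .{{_ : NonZero e}} → 1 < d → 1 < e → (p : Partition) → Regular e p → Balanced d e p → (i : Fin e) → ∃[ q ] (σ e i p ≡ just q × Balanced d e q)
theorem4p4 d e _ 1<e p _ bal i = σ-balanced e 1<e i p bal
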